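{- Let $r(n)$ be the number of $(-1)$-Dyck paths of semi-length $n$, $a(n)$ the total area of all $(-1)$-Dyck paths of semi-length $n$, $q_n=|\mathcal{Q}_n|$, and $A_n$ the total area of all paths in $\mathcal{Q}_n$. Then: (1) For $n>4$, $$A_n=2 A_{n-1}+A_{n-2}+2 A_{n-3}+q_{n}-q_{n-1}+2n q_{n-2} +2(n-5) q_{n-3}+4 n^2-14 n+13+\sum _{i=2}^{n-4} 2\bigl(A_{i}+i q_{i} +i(i+1)\bigr) (q_{n-i-1}-q_{n-i-2}),$$ with the initial values $A_1=0$, $A_2=2$, $A_3=13$, and $A_4=58$. (2) For $n\ge 4$, the sequence $a(n)$ satisfies the recursive relation $$\begin{aligned} a(n)={}&3 a(n-1)-a(n-2)+A_{n-2}+2(n-1) q_{n-2}+2 n\, r(n-1)+2(3-n) r(n-2)\\ &-4 r(n-3)+(n-1)^2+ \sum _{i=3}^{n-2} q_{i-1} \bigl(a(n-i)-a(n-i-1)\bigr)\\ &+\sum _{i=3}^{n-2} \left(A_{i-1}+(2 i-1) q_{i-1}+i^2\right) \bigl(r(n-i)-r(n-i-1)\bigr). \end{aligned}$$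
   Context: A Dyck path is a lattice path in the first quadrant that starts at the origin, ends on the $x$-axis, and consists of steps $U=(1,1)$ and $D=(1,-1)$ (never going below the $x$-axis). Its semi-length is its number of $U$ steps. A valley is an occurrence of two consecutive steps $DU$; the level of a valley is the $y$-coordinate of its lowest point. Let $\nu=(\nu_1,\dots,\nu_k)$ be the levels of all valleys of $P$, listed from left to right. A Dyck path is called $(-1)$-Dyck if it has at most one valley or if $\nu_{i+1}-\nu_i\ge -1$ for all $1\le i<k$. $\mathcal{Q}_n$ is the set of all $(-1)$-Dyck paths of semi-length $n$ that have at least one valley and whose last (rightmost) valley is at ground level (level $0$). The area of a Dyck path is the sum of the $y$-coordinates of all lattice points visited by the path (equivalently, the area of the region between the path and the $x$-axis). Sums whose upper limit is smaller than the lower limit are empty. -}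

module Defs where

open import Data.Integer
  using (ℤ; +_; 0ℤ; 1ℤ; -1ℤ; _+_; _-_; _≤_; _≥_; _≤?_; _≟_)
open import Data.List
  using (List; []; _∷_; cartesianProductWith; filter; foldr; last; length; map; upTo)
open import Data.List.Relation.Unary.All using (All; all?)
open import Data.List.Relation.Unary.Linked using (Linked; linked?)
open import Data.Maybe using (just)
open import Data.Maybe.Properties using (≡-dec)
open import Data.Nat as ℕ using (ℕ; zero; suc; _∸_)
open import Data.Product using (_×_)
open import Relation.Binary using (DecidableEquality)
open import Relation.Binary.PropositionalEquality using (_≡_; refl)
open import Relation.Nullary using (yes; no)
open import Relation.Nullary.Decidable using (_×-dec_)
open import Relation.Unary using (Decidable)

sumℤ : List ℤ → ℤ
sumℤ = foldr _+_ 0ℤ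

-- ∑ lo hi f  =  f lo + f (lo + 1) + ⋯ + f hi,  empty when hi < lo.
∑ : ℕ → ℕ → (ℕ → ℤ) → ℤ
∑ lo hi f = sumℤ (map (λ k → f (lo ℕ.+ k)) (upTo (suc hi ∸ lo)))

data Step : Set where
  U D : Step

_≟ˢ_ : DecidableEquality Step
U ≟ˢ U = yes refl
U ≟ˢ D = no λ ()
D ≟ˢ U = no λ ()
D ≟ˢ D = yes refl

Path : Set
Path = List Step

-- The y-coordinates of all lattice points visited by a path started at
-- height y, both endpoints included.
heights : ℤ → Path → List ℤ
heights y []      = y ∷ []
heights y (U ∷ p) = y ∷ heights (y + 1ℤ) p
heights y (D ∷ p) = y ∷ heights (y - 1ℤ) p

-- The levels, from left to right, of the valleys DU of a path started at
-- height y.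
valleysFrom : ℤ → Path → List ℤ
valleysFrom y []          = []
valleysFrom y (U ∷ p)     = valleysFrom (y + 1ℤ) p
valleysFrom y (D ∷ [])    = []
valleysFrom y (D ∷ U ∷ p) = (y - 1ℤ) ∷ valleysFrom (y - 1ℤ) (U ∷ p)
valleysFrom y (D ∷ D ∷ p) = valleysFrom (y - 1ℤ) (D ∷ p)

valleys : Path → List ℤ
valleys = valleysFrom 0ℤ

semilength : Path → ℕ
semilength p = length (filter (U ≟ˢ_) p)

area : Path → ℤ
area p = sumℤ (heights 0ℤ p)

IsDyck : Path → Set
IsDyck p = All (0ℤ ≤_) (heights 0ℤ p) × last (heights 0ℤ p) ≡ just 0ℤ

-- `Linked` relates consecutive entries only, and holds vacuously for lists
-- with at most one entry.
Is[-1]Dyck : Path → Set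
Is[-1]Dyck p = IsDyck p × Linked (λ ν ν′ → ν′ - ν ≥ -1ℤ) (valleys p)

-- `last` returns `nothing` on the empty list, so a valley is required to exist.
LastValleyAtGround : Path → Set
LastValleyAtGround p = last (valleys p) ≡ just 0ℤ

R : ℕ → Path → Set
R n p = semilength p ≡ n × Is[-1]Dyck p

Q : ℕ → Path → Set
Q n p = R n p × LastValleyAtGround p

isDyck? : Decidable IsDyck
isDyck? p = all? (0ℤ ≤?_) (heights 0ℤ p)
      ×-dec ≡-dec _≟_ (last (heights 0ℤ p)) (just 0ℤ)

is[-1]Dyck? : Decidable Is[-1]Dyck
is[-1]Dyck? p = isDyck? p
          ×-dec linked? (λ ν ν′ → -1ℤ ≤? (ν′ - ν)) (valleys p)

R? : ∀ n → Decidable (R n)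
R? n p = (semilength p ℕ.≟ n) ×-dec is[-1]Dyck? p

Q? : ∀ n → Decidable (Q n)
Q? n p = R? n p ×-dec ≡-dec _≟_ (last (valleys p)) (just 0ℤ)

-- Every path with m steps, exactly once.
words : ℕ → List Path
words zero    = [] ∷ []
words (suc m) = cartesianProductWith _∷_ (U ∷ D ∷ []) (words m)

-- A Dyck path has as many D steps as U steps, so those of semi-length n are
-- all found among the words with 2n steps.
Rpaths Qpaths : ℕ → List Path
Rpaths n = filter (R? n) (words (2 ℕ.* n))
Qpaths n = filter (Q? n) (words (2 ℕ.* n))

r a q A : ℕ → ℤ
r n = + length (Rpaths n)
a n = sumℤ (map area (Rpaths n))
q n = + length (Qpaths n)
A n = sumℤ (map area (Qpaths n))

{-# OPTIONS --safe #-}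
module Submission where

-- A nonempty Dyck path is split at its first return to the axis as U p D p′.  If
-- p′ is empty, this is a (-1)-Dyck path exactly when p is one.  Otherwise there is
-- a valley at level 0 at the split; it may follow the valleys of the raised path p
-- only if the last of them, if any, is at level 0 in p, and it imposes no condition
-- on the valleys of p′.  Let S consist of the (-1)-Dyck paths whose last valley, if
-- any, is at ground level: these are the paths of Q and the pyramids Uⁿ Dⁿ, n ≥ 0.
-- With ε the empty path, the decompositions are
--
--     R  =  ε  ⊎  U R D  ⊎  U S D (R ∖ ε),        Q  =  U S D (S ∖ ε).
--
-- Since U p D has area 2n + 1 more than a path p of semi-length n, and area is
-- additive under concatenation, counting and summing areas gives four convolution
-- identities for r, a, q and A (r-step, a-step, q-step and A-step).
--
-- In terms of generating functions, S is Q + 1 / (1 - x), so (1 - x) S is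
-- 1 + (1 - x) Q.  Multiplying the identities by 1 - x, that is, taking differences
-- of consecutive values, turns the convolutions with S into convolutions with
-- differences of q or of the other factor (conv-Δ).  Splitting off the terms of
-- small index, where r, a, q and A have known values, yields a-recurrence.  For A
-- the result still contains the convolution of s = 1 + q with the differences of
-- q; the identity q-diff evaluates it, and A-recurrence follows.
--
-- The decompositions are proved for binary trees, which correspond to Dyck paths
-- (word-injective and isDyck⇒word): on trees the split at the first return is the
-- root.  A list without repetitions is determined up to permutation by its
-- members (enum-↭), so it suffices to show that both sides of a decomposition
-- list the same trees (enum-Rnodes and enum-Qnodes).

open import Defs
open import Data.Empty using (⊥; ⊥-elim)
open import Data.Integer using (+_; _+_; _-_; _*_; _^_)
open import Data.Integer using (ℤ; 0ℤ; 1ℤ; -1ℤ; -_; _≤_; +≤+)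
import Data.Integer.Properties as ℤ
open import Data.Integer.Tactic.RingSolver using (solve-∀)
open import Data.List
  using (List; []; _∷_; _++_; applyUpTo; cartesianProductWith; filter; last; length; map)
open import Data.List.Membership.Propositional using (_∈_)
open import Data.List.Membership.Propositional.Properties
  using (∈-map⁺; ∈-map⁻; ∈-++⁺ˡ; ∈-++⁺ʳ; ∈-++⁻; ∈-cartesianProductWith⁺;
         ∈-cartesianProductWith⁻; ∈-filter⁺; ∈-filter⁻)
open import Data.List.Membership.Propositional.Properties.WithK using (unique∧set⇒bag)
open import Data.List.Properties
  using (++-assoc; ++-identityʳ; ∷-injective; ∷-injectiveʳ; last-map; length-++;
         length-map; map-++; map-cong; map-upTo; map-∘)
open import Data.List.Relation.Binary.BagAndSetEquality using (∼bag⇒↭)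
open import Data.List.Relation.Binary.Permutation.Propositional as ↭ using (_↭_)
open import Data.List.Relation.Unary.All as All using (All; []; _∷_)
open import Data.List.Relation.Unary.AllPairs using ([]; _∷_)
open import Data.List.Relation.Unary.Any using (here; there)
open import Data.List.Relation.Unary.Linked as Linked using (Linked; []; [-]; _∷_)
import Data.List.Relation.Unary.Linked.Properties as Linked
open import Data.List.Relation.Unary.Unique.Propositional using (Unique)
import Data.List.Relation.Unary.Unique.Propositional.Properties as Unique
open import Data.Maybe as Maybe using (Maybe; just; nothing)
import Data.Maybe.Properties as Maybe
open import Data.Nat using (ℕ; _∸_; _>_; _≥_)
open import Data.Nat as ℕ using (zero; suc; s≤s; z≤n)
import Data.Nat.Properties as ℕ
import Data.Nat.Tactic.RingSolver as ℕ-Solver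
open import Data.Product using (_×_)
open import Data.Product using (∃; ∃₂; _,_; proj₁; proj₂)
open import Data.Sum using (_⊎_; inj₁; inj₂)
open import Data.Unit using (⊤)
open import Data.Vec using (Vec; []; _∷_)
open import Function using (_∘_; mk⇔)
open import Relation.Binary.PropositionalEquality using (_≡_)
open import Relation.Binary.PropositionalEquality
  using (_≢_; _≗_; refl; sym; trans; cong; cong₂; subst; subst₂; module ≡-Reasoning)
open import Relation.Nullary using (Dec; ¬_)

-- Sums and convolutions of integer sequences

+-congˡ : ∀ (x : ℤ) {y z : ℤ} → y ≡ z → x + y ≡ x + z
+-congˡ x = cong (λ y → x + y)

-- Σ< n f  =  f 0 + f 1 + ⋯ + f (n - 1).
Σ< : ℕ → (ℕ → ℤ) → ℤ
Σ< zero    f = 0ℤ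
Σ< (suc n) f = f 0 + Σ< n (f ∘ suc)

Σ<-cong : ∀ n {f g : ℕ → ℤ} → (∀ k → k ℕ.< n → f k ≡ g k) → Σ< n f ≡ Σ< n g
Σ<-cong zero    f≡g = refl
Σ<-cong (suc n) f≡g =
  cong₂ _+_ (f≡g 0 (s≤s z≤n)) (Σ<-cong n λ k k<n → f≡g (suc k) (s≤s k<n))

sum-applyUpTo : ∀ f n → sumℤ (applyUpTo f n) ≡ Σ< n f
sum-applyUpTo f zero    = refl
sum-applyUpTo f (suc n) = +-congˡ (f 0) (sum-applyUpTo (f ∘ suc) n)

∑≡Σ< : ∀ lo hi f → ∑ lo hi f ≡ Σ< (suc hi ∸ lo) (λ k → f (lo ℕ.+ k))
∑≡Σ< lo hi f = trans (cong sumℤ (map-upTo _ (suc hi ∸ lo))) (sum-applyUpTo _ (suc hi ∸ lo))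

-- The convolution, that is, the coefficient of xⁿ in the product of the
-- generating functions of f and g.
conv : (ℕ → ℤ) → (ℕ → ℤ) → ℕ → ℤ
conv f g n = Σ< (suc n) λ i → f i * g (n ∸ i)

-- The backward difference: multiplication of the generating function by 1 - x.
Δ : (ℕ → ℤ) → ℕ → ℤ
Δ g zero    = g 0
Δ g (suc n) = g (suc n) - g n

conv-cong : ∀ {f f′ g g′ : ℕ → ℤ} → f ≗ f′ → g ≗ g′ → conv f g ≗ conv f′ g′
conv-cong f≡ g≡ n = Σ<-cong (suc n) λ i _ → cong₂ _*_ (f≡ i) (g≡ (n ∸ i))

conv-+ˡ : ∀ f f′ g n → conv (λ i → f i + f′ i) g n ≡ conv f g n + conv f′ g n
conv-+ˡ f f′ g zero    = lemma (f 0) (f′ 0) (g 0)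
  where
  lemma : ∀ a b c → (a + b) * c + 0ℤ ≡ (a * c + 0ℤ) + (b * c + 0ℤ)
  lemma = solve-∀
conv-+ˡ f f′ g (suc n) = trans
  (+-congˡ ((f 0 + f′ 0) * g (suc n)) (conv-+ˡ (f ∘ suc) (f′ ∘ suc) g n))
  (lemma (f 0) (f′ 0) (g (suc n)) (conv (f ∘ suc) g n) (conv (f′ ∘ suc) g n))
  where
  lemma : ∀ a b c u v → (a + b) * c + (u + v) ≡ (a * c + u) + (b * c + v)
  lemma = solve-∀

-- The last term split off; in the rest the argument of g is shifted.
conv-last : ∀ f g n → conv f g (suc n) ≡ conv f (g ∘ suc) n + f (suc n) * g 0
conv-last f g zero    = lemma (f 0 * g 1) (f 1 * g 0)
  where
  lemma : ∀ a b → a + (b + 0ℤ) ≡ (a + 0ℤ) + b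
  lemma = solve-∀
conv-last f g (suc n) = trans
  (+-congˡ (f 0 * g (2 ℕ.+ n)) (conv-last (f ∘ suc) g n))
  (sym (ℤ.+-assoc (f 0 * g (2 ℕ.+ n)) _ _))

conv-last₂ : ∀ f g n → conv f g (2 ℕ.+ n) ≡
  conv f (g ∘ suc ∘ suc) n + f (1 ℕ.+ n) * g 1 + f (2 ℕ.+ n) * g 0
conv-last₂ f g n = trans (conv-last f g (suc n))
  (cong (_+ f (2 ℕ.+ n) * g 0) (conv-last f (g ∘ suc) n))

-- The last term split off; in the rest the summands are unchanged.
conv≡Σ<+last : ∀ f g n → conv f g n ≡ Σ< n (λ i → f i * g (n ∸ i)) + f n * g 0
conv≡Σ<+last f g zero    = ℤ.+-comm (f 0 * g 0) 0ℤ
conv≡Σ<+last f g (suc n) = trans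
  (+-congˡ (f 0 * g (suc n)) (conv≡Σ<+last (f ∘ suc) g n))
  (sym (ℤ.+-assoc (f 0 * g (suc n)) _ _))

-- The first two and the last two terms split off.
conv-ends : ∀ f g m → conv f g (3 ℕ.+ m) ≡
  f 0 * g (3 ℕ.+ m) + (f 1 * g (2 ℕ.+ m)
    + (Σ< m (λ k → f (2 ℕ.+ k) * g (suc (m ∸ k))) + f (2 ℕ.+ m) * g 1 + f (3 ℕ.+ m) * g 0))
conv-ends f g m = cong (λ x → f 0 * g (3 ℕ.+ m) + (f 1 * g (2 ℕ.+ m) + x))
  (trans (conv-last f₂ g m)
    (cong (_+ f₂ (suc m) * g 0) (conv≡Σ<+last f₂ (g ∘ suc) m)))
  where
  f₂ : ℕ → ℤ
  f₂ k = f (2 ℕ.+ k)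

conv-comm : ∀ f g → conv f g ≗ conv g f
conv-comm f g zero    = cong (_+ 0ℤ) (ℤ.*-comm (f 0) (g 0))
conv-comm f g (suc n) = begin
  f 0 * g (suc n) + conv (f ∘ suc) g n
    ≡⟨ cong₂ _+_ (ℤ.*-comm (f 0) _) (conv-comm (f ∘ suc) g n) ⟩
  g (suc n) * f 0 + conv g (f ∘ suc) n
    ≡⟨ ℤ.+-comm (g (suc n) * f 0) _ ⟩
  conv g (f ∘ suc) n + g (suc n) * f 0
    ≡⟨ conv-last g f n ⟨
  conv g f (suc n) ∎
  where open ≡-Reasoning

-- Multiplying one factor by 1 - x multiplies the product by 1 - x.
conv-Δ : ∀ f g n → conv f g (suc n) ≡ conv f g n + conv f (Δ g) (suc n)
conv-Δ f g zero    = lemma (f 0) (f 1) (g 0) (g 1)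
  where
  lemma : ∀ a b c d → a * d + (b * c + 0ℤ) ≡ (a * c + 0ℤ) + (a * (d - c) + (b * c + 0ℤ))
  lemma = solve-∀
conv-Δ f g (suc n) = trans
  (+-congˡ (f 0 * g (2 ℕ.+ n)) (conv-Δ (f ∘ suc) g n))
  (lemma (f 0) (g (1 ℕ.+ n)) (g (2 ℕ.+ n)) (conv (f ∘ suc) g n) (conv (f ∘ suc) (Δ g) (suc n)))
  where
  lemma : ∀ a c d u v → a * d + (u + v) ≡ (a * c + u) + (a * (d - c) + v)
  lemma = solve-∀

-- The constant sequence 1 has generating function 1 / (1 - x).
conv-1-Δ : ∀ g → conv (λ _ → 1ℤ) (Δ g) ≗ g
conv-1-Δ g zero    = lemma (g 0)
  where
  lemma : ∀ a → 1ℤ * a + 0ℤ ≡ a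
  lemma = solve-∀
conv-1-Δ g (suc n) = trans (+-congˡ (1ℤ * (g (suc n) - g n)) (conv-1-Δ g n)) (lemma (g (suc n)) (g n))
  where
  lemma : ∀ a b → 1ℤ * (a - b) + b ≡ a
  lemma = solve-∀

-- The sequence with its 0th term replaced by 0.
drop₀ : (ℕ → ℤ) → ℕ → ℤ
drop₀ f zero    = 0ℤ
drop₀ f (suc n) = f (suc n)

-- From convolution identities to the recurrences

-- The recurrences, for any sequences satisfying the convolution identities
-- q-step, A-step, r-step and a-step.
module Recurrences
  (r a q A : ℕ → ℤ)
  (q0 : q 0 ≡ 0ℤ) (q1 : q 1 ≡ 0ℤ) (q2 : q 2 ≡ 1ℤ)
  (A0 : A 0 ≡ 0ℤ) (A1 : A 1 ≡ 0ℤ)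
  (r1 : r 1 ≡ 1ℤ) (a0 : a 0 ≡ 0ℤ) (a1 : a 1 ≡ 1ℤ)
  where

  -- The number s n and the total area B n of the paths of semi-length n that are
  -- in class Q or are the pyramid Uⁿ Dⁿ, which has area n².  T n is the total
  -- area of these paths after each has been raised by one: the path U p D has
  -- area 2n + 1 more than p.
  s B T : ℕ → ℤ
  s n = 1ℤ + q n
  B n = + n * + n + A n
  T n = B n + (+ 2 * + n + 1ℤ) * s n

  module FromConvolutions
    (q-step : ∀ n → q (suc n) ≡ conv s (drop₀ s) n)
    (A-step : ∀ n → A (suc n) ≡ conv T (drop₀ s) n + conv s B n)
    (r-step : ∀ n → r (suc n) ≡ r n + conv s (drop₀ r) n)
    (a-step : ∀ n → a (suc n) ≡ (a n + (+ 2 * + n + 1ℤ) * r n)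
                              + (conv T (drop₀ r) n + conv s a n))
    where

    -- Δ q shifted by two; the terms Δ q 0 and Δ q 1 vanish.
    Δq₂ : ℕ → ℤ
    Δq₂ n = q (2 ℕ.+ n) - q (1 ℕ.+ n)

    -- Δ s is Δ q with 1 added at index 0, as (1 - x) / (1 - x) = 1.
    Δs-conv : ∀ f n → conv f (Δ s) (2 ℕ.+ n) ≡ conv f Δq₂ n + f (2 ℕ.+ n)
    Δs-conv f n = begin
      conv f (Δ s) (2 ℕ.+ n)
        ≡⟨ conv-last₂ f (Δ s) n ⟩
      conv f (Δ s ∘ suc ∘ suc) n + f (1 ℕ.+ n) * ((1ℤ + q 1) - (1ℤ + q 0)) + f (2 ℕ.+ n) * (1ℤ + q 0)
        ≡⟨ cong₂ (λ x y → x + f (1 ℕ.+ n) * ((1ℤ + q 1) - (1ℤ + y)) + f (2 ℕ.+ n) * (1ℤ + y))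
             (conv-cong {f} {f} (λ _ → refl) (λ i → lemma₁ (q (2 ℕ.+ i)) (q (1 ℕ.+ i))) n) q0 ⟩
      conv f Δq₂ n + f (1 ℕ.+ n) * ((1ℤ + q 1) - (1ℤ + 0ℤ)) + f (2 ℕ.+ n) * (1ℤ + 0ℤ)
        ≡⟨ cong (λ x → conv f Δq₂ n + f (1 ℕ.+ n) * ((1ℤ + x) - (1ℤ + 0ℤ)) + f (2 ℕ.+ n) * (1ℤ + 0ℤ)) q1 ⟩
      conv f Δq₂ n + f (1 ℕ.+ n) * 0ℤ + f (2 ℕ.+ n) * 1ℤ
        ≡⟨ lemma₂ (conv f Δq₂ n) (f (1 ℕ.+ n)) (f (2 ℕ.+ n)) ⟩
      conv f Δq₂ n + f (2 ℕ.+ n) ∎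
      where
      open ≡-Reasoning
      lemma₁ : ∀ x y → (1ℤ + x) - (1ℤ + y) ≡ x - y
      lemma₁ = solve-∀
      lemma₂ : ∀ c x y → c + x * 0ℤ + y * 1ℤ ≡ c + y
      lemma₂ = solve-∀

    -- Likewise Δ (drop₀ s) is Δ q with 1 added at index 1.
    Δdrop₀s-conv : ∀ f n → conv f (Δ (drop₀ s)) (2 ℕ.+ n) ≡ conv f Δq₂ n + f (1 ℕ.+ n)
    Δdrop₀s-conv f n = begin
      conv f (Δ (drop₀ s)) (2 ℕ.+ n)
        ≡⟨ conv-last₂ f (Δ (drop₀ s)) n ⟩
      conv f (Δ s ∘ suc ∘ suc) n + f (1 ℕ.+ n) * ((1ℤ + q 1) - 0ℤ) + f (2 ℕ.+ n) * 0ℤ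
        ≡⟨ cong₂ (λ x y → x + f (1 ℕ.+ n) * ((1ℤ + y) - 0ℤ) + f (2 ℕ.+ n) * 0ℤ)
             (conv-cong {f} {f} (λ _ → refl) (λ i → lemma₁ (q (2 ℕ.+ i)) (q (1 ℕ.+ i))) n) q1 ⟩
      conv f Δq₂ n + f (1 ℕ.+ n) * 1ℤ + f (2 ℕ.+ n) * 0ℤ
        ≡⟨ lemma₂ (conv f Δq₂ n) (f (1 ℕ.+ n)) (f (2 ℕ.+ n)) ⟩
      conv f Δq₂ n + f (1 ℕ.+ n) ∎
      where
      open ≡-Reasoning
      lemma₁ : ∀ x y → (1ℤ + x) - (1ℤ + y) ≡ x - y
      lemma₁ = solve-∀
      lemma₂ : ∀ c x y → c + x * 1ℤ + y * 0ℤ ≡ c + x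
      lemma₂ = solve-∀

    q-diff : ∀ n → q (3 ℕ.+ n) ≡ q (2 ℕ.+ n) + (conv s Δq₂ n + s (1 ℕ.+ n))
    q-diff n = begin
      q (3 ℕ.+ n)
        ≡⟨ q-step (2 ℕ.+ n) ⟩
      conv s (drop₀ s) (2 ℕ.+ n)
        ≡⟨ conv-Δ s (drop₀ s) (suc n) ⟩
      conv s (drop₀ s) (1 ℕ.+ n) + conv s (Δ (drop₀ s)) (2 ℕ.+ n)
        ≡⟨ cong₂ _+_ (sym (q-step (suc n))) (Δdrop₀s-conv s n) ⟩
      q (2 ℕ.+ n) + (conv s Δq₂ n + s (1 ℕ.+ n)) ∎
      where open ≡-Reasoning

    A-diff : ∀ n → A (3 ℕ.+ n) ≡
      A (2 ℕ.+ n) + ((conv T Δq₂ n + T (1 ℕ.+ n)) + (conv B Δq₂ n + B (2 ℕ.+ n)))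
    A-diff n = begin
      A (3 ℕ.+ n)
        ≡⟨ A-step (2 ℕ.+ n) ⟩
      conv T (drop₀ s) (2 ℕ.+ n) + conv s B (2 ℕ.+ n)
        ≡⟨ cong₂ _+_ (conv-Δ T (drop₀ s) (suc n))
             (trans (conv-comm s B (2 ℕ.+ n)) (conv-Δ B s (suc n))) ⟩
      (conv T (drop₀ s) (1 ℕ.+ n) + conv T (Δ (drop₀ s)) (2 ℕ.+ n))
        + (conv B s (1 ℕ.+ n) + conv B (Δ s) (2 ℕ.+ n))
        ≡⟨ lemma (conv T (drop₀ s) (1 ℕ.+ n)) _ (conv B s (1 ℕ.+ n)) _ ⟩
      (conv T (drop₀ s) (1 ℕ.+ n) + conv B s (1 ℕ.+ n))
        + (conv T (Δ (drop₀ s)) (2 ℕ.+ n) + conv B (Δ s) (2 ℕ.+ n))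
        ≡⟨ cong₂ _+_
             (trans (+-congˡ (conv T (drop₀ s) (1 ℕ.+ n)) (conv-comm B s (1 ℕ.+ n))) (sym (A-step (suc n))))
             (cong₂ _+_ (Δdrop₀s-conv T n) (Δs-conv B n)) ⟩
      A (2 ℕ.+ n) + ((conv T Δq₂ n + T (1 ℕ.+ n)) + (conv B Δq₂ n + B (2 ℕ.+ n))) ∎
      where
      open ≡-Reasoning
      lemma : ∀ w x y z → (w + x) + (y + z) ≡ (w + y) + (x + z)
      lemma = solve-∀

    -- The factor of q (n - i - 1) - q (n - i - 2) in the recurrence for A n.
    F : ℕ → ℤ
    F i = + 2 * (A i + + i * q i + + i * (+ i + + 1))

    -- T i + B i exceeds F i by s i exactly; the convolution of s with Δ q is then
    -- eliminated by q-diff, which brings in the terms q n - q (n - 1).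
    T+B : ∀ n → conv T Δq₂ n + conv B Δq₂ n ≡ conv F Δq₂ n + conv s Δq₂ n
    T+B n = begin
      conv T Δq₂ n + conv B Δq₂ n
        ≡⟨ conv-+ˡ T B Δq₂ n ⟨
      conv (λ i → T i + B i) Δq₂ n
        ≡⟨ conv-cong {g = Δq₂} (λ i → lemma (A i) (q i) (+ i)) (λ _ → refl) n ⟩
      conv (λ i → F i + s i) Δq₂ n
        ≡⟨ conv-+ˡ F s Δq₂ n ⟩
      conv F Δq₂ n + conv s Δq₂ n ∎
      where
      open ≡-Reasoning
      lemma : ∀ A q i →
        ((i * i + A) + (+ 2 * i + + 1) * (+ 1 + q)) + (i * i + A)
        ≡ + 2 * (A + i * q + i * (i + + 1)) + (+ 1 + q)
      lemma = solve-∀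

    F-split : ∀ m → conv F Δq₂ (2 ℕ.+ m) ≡
      F 0 * Δq₂ (2 ℕ.+ m) + (F 1 * Δq₂ (1 ℕ.+ m)
        + (Σ< m (λ k → F (2 ℕ.+ k) * Δq₂ (m ∸ k)) + F (2 ℕ.+ m) * Δq₂ 0))
    F-split m = cong (λ x → F 0 * Δq₂ (2 ℕ.+ m) + (F 1 * Δq₂ (1 ℕ.+ m) + x))
      (conv≡Σ<+last (F ∘ suc ∘ suc) Δq₂ m)

    -- Rewriting n - i as a shift of m - k needs k below m, where ∸ does not truncate.
    A-sum : ∀ m → ∑ 2 (1 ℕ.+ m) (λ i → F i * (q (5 ℕ.+ m ∸ i ∸ 1) - q (5 ℕ.+ m ∸ i ∸ 2)))
      ≡ Σ< m (λ k → F (2 ℕ.+ k) * Δq₂ (m ∸ k))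
    A-sum m = trans
      (∑≡Σ< 2 (1 ℕ.+ m) (λ i → F i * (q (5 ℕ.+ m ∸ i ∸ 1) - q (5 ℕ.+ m ∸ i ∸ 2))))
      (Σ<-cong m λ k k<m → cong
      (λ j → F (2 ℕ.+ k) * (q (j ∸ 1) - q (j ∸ 2))) (ℕ.+-∸-assoc 3 (ℕ.<⇒≤ k<m)))

    -- The terms of the convolution for i = 0, i = 1 and i ≥ n - 3 are evaluated
    -- separately, the values of q and A for small arguments being known.
    A-recurrence : ∀ m → let n = 5 ℕ.+ m in
      A n ≡ + 2 * A (n ∸ 1) + A (n ∸ 2) + + 2 * A (n ∸ 3)
          + q n - q (n ∸ 1)
          + + 2 * + n * q (n ∸ 2)
          + + 2 * (+ n - + 5) * q (n ∸ 3)
          + + 4 * (+ n) ^ 2 - + 14 * + n + + 13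
          + ∑ 2 (n ∸ 4) (λ i →
              + 2 * (A i + + i * q i + + i * (+ i + + 1))
                * (q (n ∸ i ∸ 1) - q (n ∸ i ∸ 2)))
    A-recurrence m = begin
      A (5 ℕ.+ m)
        ≡⟨ A-diff (2 ℕ.+ m) ⟩
      A (4 ℕ.+ m) + ((cT + T (3 ℕ.+ m)) + (cB + B (4 ℕ.+ m)))
        ≡⟨ lemma₁ (A (4 ℕ.+ m)) cT (T (3 ℕ.+ m)) cB (B (4 ℕ.+ m)) ⟩
      A (4 ℕ.+ m) + (cT + cB) + T (3 ℕ.+ m) + B (4 ℕ.+ m)
        ≡⟨ cong (λ x → A (4 ℕ.+ m) + x + T (3 ℕ.+ m) + B (4 ℕ.+ m)) (T+B (2 ℕ.+ m)) ⟩
      A (4 ℕ.+ m) + (cF + cs) + T (3 ℕ.+ m) + B (4 ℕ.+ m)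
        ≡⟨ cong₂ (λ x y → A (4 ℕ.+ m) + (x + y) + T (3 ℕ.+ m) + B (4 ℕ.+ m)) cF≡ cs≡ ⟩
      _
        ≡⟨ lemma₂ (+ m) (A (4 ℕ.+ m)) (A (3 ℕ.+ m)) (A (2 ℕ.+ m)) (q (5 ℕ.+ m)) (q (4 ℕ.+ m))
             (q (3 ℕ.+ m)) (q (2 ℕ.+ m)) Σ′ ⟩
      L + Σ′
        ≡⟨ +-congˡ L (A-sum m) ⟨
      _ ∎
      where
      open ≡-Reasoning
      n  = 5 ℕ.+ m
      L  = + 2 * A (4 ℕ.+ m) + A (3 ℕ.+ m) + + 2 * A (2 ℕ.+ m)
          + q n - q (4 ℕ.+ m)
          + + 2 * + n * q (3 ℕ.+ m)
          + + 2 * (+ n - + 5) * q (2 ℕ.+ m)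
          + + 4 * (+ n) ^ 2 - + 14 * + n + + 13
      cT = conv T Δq₂ (2 ℕ.+ m)
      cB = conv B Δq₂ (2 ℕ.+ m)
      cF = conv F Δq₂ (2 ℕ.+ m)
      cs = conv s Δq₂ (2 ℕ.+ m)
      Σ′ = Σ< m (λ k → F (2 ℕ.+ k) * Δq₂ (m ∸ k))

      lemma₁ : ∀ a t t′ b b′ → a + ((t + t′) + (b + b′)) ≡ a + (t + b) + t′ + b′
      lemma₁ = solve-∀

      cs≡ : cs ≡ q (5 ℕ.+ m) - q (4 ℕ.+ m) - s (3 ℕ.+ m)
      cs≡ = trans (lemma (q (4 ℕ.+ m)) cs (s (3 ℕ.+ m)))
        (cong (λ x → x - q (4 ℕ.+ m) - s (3 ℕ.+ m)) (sym (q-diff (2 ℕ.+ m))))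
        where
        lemma : ∀ x y z → y ≡ (x + (y + z)) - x - z
        lemma = solve-∀

      F0 : F 0 ≡ 0ℤ
      F0 = cong (λ x → + 2 * (x + 0ℤ * q 0 + 0ℤ)) A0
      F1 : F 1 ≡ + 4
      F1 = cong₂ (λ x y → + 2 * (x + 1ℤ * y + + 2)) A1 q1

      Δq₂0 : Δq₂ 0 ≡ 1ℤ
      Δq₂0 = cong₂ _-_ q2 q1

      cF≡ : cF ≡ 0ℤ * Δq₂ (2 ℕ.+ m) + (+ 4 * Δq₂ (1 ℕ.+ m) + (Σ′ + F (2 ℕ.+ m) * 1ℤ))
      cF≡ = trans (F-split m)
        (trans (cong₂ (λ x y → x * Δq₂ (2 ℕ.+ m) + (y * Δq₂ (1 ℕ.+ m) + (Σ′ + F (2 ℕ.+ m) * Δq₂ 0))) F0 F1)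
          (cong (λ x → 0ℤ * Δq₂ (2 ℕ.+ m) + (+ 4 * Δq₂ (1 ℕ.+ m) + (Σ′ + F (2 ℕ.+ m) * x))) Δq₂0))

      lemma₂ : ∀ m A4 A3 A2 q5 q4 q3 q2 Σ′ →
        A4 + ((0ℤ * (q4 - q3) + (+ 4 * (q3 - q2)
               + (Σ′ + + 2 * (A2 + (+ 2 + m) * q2 + (+ 2 + m) * ((+ 2 + m) + + 1)) * + 1)))
             + (q5 - q4 - (+ 1 + q3)))
           + (((+ 3 + m) * (+ 3 + m) + A3) + (+ 2 * (+ 3 + m) + + 1) * (+ 1 + q3))
           + ((+ 4 + m) * (+ 4 + m) + A4)
        ≡ + 2 * A4 + A3 + + 2 * A2 + q5 - q4 + + 2 * (+ 5 + m) * q3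
          + + 2 * ((+ 5 + m) - + 5) * q2
          + + 4 * ((+ 5 + m) * ((+ 5 + m) * + 1)) - + 14 * (+ 5 + m) + + 13 + Σ′
      lemma₂ = solve-∀

    -- The sums in the recurrence for a n omit the first two and the last two terms
    -- of the convolutions.
    Tr-ends : ∀ m → conv T (Δ (drop₀ r)) (3 ℕ.+ m) ≡
      T 0 * (r (3 ℕ.+ m) - r (2 ℕ.+ m)) + (T 1 * (r (2 ℕ.+ m) - r (1 ℕ.+ m))
        + (Σ< m (λ k → T (2 ℕ.+ k) * Δ (drop₀ r) (suc (m ∸ k)))
           + T (2 ℕ.+ m) * 1ℤ + T (3 ℕ.+ m) * 0ℤ))
    Tr-ends m = trans (conv-ends T (Δ (drop₀ r)) m)
      (cong (λ x → T 0 * (r (3 ℕ.+ m) - r (2 ℕ.+ m)) + (T 1 * (r (2 ℕ.+ m) - r (1 ℕ.+ m))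
        + (Σ< m (λ k → T (2 ℕ.+ k) * Δ (drop₀ r) (suc (m ∸ k)))
           + T (2 ℕ.+ m) * x + T (3 ℕ.+ m) * 0ℤ)))
        (trans (ℤ.+-identityʳ (r 1)) r1))

    qa-ends : ∀ m → conv q (Δ a) (3 ℕ.+ m) ≡
      0ℤ * (a (3 ℕ.+ m) - a (2 ℕ.+ m)) + (0ℤ * (a (2 ℕ.+ m) - a (1 ℕ.+ m))
        + (Σ< m (λ k → q (2 ℕ.+ k) * (a (suc (m ∸ k)) - a (m ∸ k)))
           + q (2 ℕ.+ m) * 1ℤ + q (3 ℕ.+ m) * 0ℤ))
    qa-ends m = trans (conv-ends q (Δ a) m) (trans
      (cong₂ (λ x y → x * (a (3 ℕ.+ m) - a (2 ℕ.+ m)) + (y * (a (2 ℕ.+ m) - a (1 ℕ.+ m))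
        + (S + q (2 ℕ.+ m) * (a 1 - a 0) + q (3 ℕ.+ m) * a 0))) q0 q1)
      (cong₂ (λ x y → 0ℤ * (a (3 ℕ.+ m) - a (2 ℕ.+ m)) + (0ℤ * (a (2 ℕ.+ m) - a (1 ℕ.+ m))
        + (S + q (2 ℕ.+ m) * (x - y) + q (3 ℕ.+ m) * y))) a1 a0))
      where
      S = Σ< m (λ k → q (2 ℕ.+ k) * (a (suc (m ∸ k)) - a (m ∸ k)))

    -- The summand 1 of s i = 1 + q i contributes g itself.
    s-conv : ∀ g → conv s (Δ g) ≗ λ n → g n + conv q (Δ g) n
    s-conv g n = trans (conv-+ˡ (λ _ → 1ℤ) q (Δ g) n)
      (cong (_+ conv q (Δ g) n) (conv-1-Δ g n))

    a-diff : ∀ n → a (2 ℕ.+ n) ≡ a (1 ℕ.+ n)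
      + ((a (1 ℕ.+ n) - a n)
      + ((+ 2 * + suc n + 1ℤ) * r (suc n) - (+ 2 * + n + 1ℤ) * r n)
      + conv T (Δ (drop₀ r)) (suc n) + (a (suc n) + conv q (Δ a) (suc n)))
    a-diff n = begin
      a (2 ℕ.+ n)
        ≡⟨ a-step (suc n) ⟩
      (a (suc n) + w′) + (conv T (drop₀ r) (suc n) + conv s a (suc n))
        ≡⟨ +-congˡ (a (suc n) + w′) (cong₂ _+_ (conv-Δ T (drop₀ r) n) (conv-Δ s a n)) ⟩
      (a (suc n) + w′) + ((cT + dT) + (cs + conv s (Δ a) (suc n)))
        ≡⟨ cong (λ x → (a (suc n) + w′) + ((cT + dT) + (cs + x))) (s-conv a (suc n)) ⟩
      (a (suc n) + w′) + ((cT + dT) + (cs + ds))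
        ≡⟨ lemma (a (suc n)) (a n) w w′ cT dT cs ds ⟩
      ((a n + w) + (cT + cs)) + ((a (suc n) - a n) + (w′ - w) + dT + ds)
        ≡⟨ cong (λ x → x + ((a (suc n) - a n) + (w′ - w) + dT + ds)) (a-step n) ⟨
      a (suc n) + ((a (suc n) - a n) + (w′ - w) + dT + ds) ∎
      where
      open ≡-Reasoning
      w  = (+ 2 * + n + 1ℤ) * r n
      w′ = (+ 2 * + suc n + 1ℤ) * r (suc n)
      cT = conv T (drop₀ r) n
      dT = conv T (Δ (drop₀ r)) (suc n)
      cs = conv s a n
      ds = a (suc n) + conv q (Δ a) (suc n)
      lemma : ∀ a′ a w w′ cT dT cs ds → (a′ + w′) + ((cT + dT) + (cs + ds))
        ≡ ((a + w) + (cT + cs)) + ((a′ - a) + (w′ - w) + dT + ds)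
      lemma = solve-∀

    qa-sum : ∀ m → ∑ 3 (2 ℕ.+ m) (λ i → q (i ∸ 1) * (a (4 ℕ.+ m ∸ i) - a (4 ℕ.+ m ∸ i ∸ 1)))
      ≡ Σ< m (λ k → q (2 ℕ.+ k) * (a (suc (m ∸ k)) - a (m ∸ k)))
    qa-sum m = trans
      (∑≡Σ< 3 (2 ℕ.+ m) (λ i → q (i ∸ 1) * (a (4 ℕ.+ m ∸ i) - a (4 ℕ.+ m ∸ i ∸ 1))))
      (Σ<-cong m λ k k<m → cong
        (λ j → q (2 ℕ.+ k) * (a j - a (j ∸ 1))) (ℕ.+-∸-assoc 1 (ℕ.<⇒≤ k<m)))

    Tr-sum : ∀ m → ∑ 3 (2 ℕ.+ m) (λ i →
        (A (i ∸ 1) + (+ 2 * + i - + 1) * q (i ∸ 1) + (+ i) ^ 2)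
          * (r (4 ℕ.+ m ∸ i) - r (4 ℕ.+ m ∸ i ∸ 1)))
      ≡ Σ< m (λ k → T (2 ℕ.+ k) * Δ (drop₀ r) (suc (m ∸ k)))
    Tr-sum m = trans
      (∑≡Σ< 3 (2 ℕ.+ m) (λ i →
        (A (i ∸ 1) + (+ 2 * + i - + 1) * q (i ∸ 1) + (+ i) ^ 2)
          * (r (4 ℕ.+ m ∸ i) - r (4 ℕ.+ m ∸ i ∸ 1))))
      (Σ<-cong m λ k k<m → cong₂ _*_
        (lemma (+ k) (A (2 ℕ.+ k)) (q (2 ℕ.+ k)))
        (trans (cong (λ j → r j - r (j ∸ 1)) (ℕ.+-∸-assoc 1 (ℕ.<⇒≤ k<m)))
               (+-congˡ (r (suc (m ∸ k))) (cong -_ (drop₀-pos r (ℕ.m<n⇒0<n∸m k<m))))))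
      where
      drop₀-pos : ∀ f {n} → 0 ℕ.< n → f n ≡ drop₀ f n
      drop₀-pos f {suc n} _ = refl
      lemma : ∀ k A q →
        A + (+ 2 * (+ 3 + k) - + 1) * q + (+ 3 + k) * ((+ 3 + k) * + 1)
        ≡ ((+ 2 + k) * (+ 2 + k) + A) + (+ 2 * (+ 2 + k) + + 1) * (+ 1 + q)
      lemma = solve-∀

    a-recurrence : ∀ m → let n = 4 ℕ.+ m in
        a n ≡ + 3 * a (n ∸ 1) - a (n ∸ 2) + A (n ∸ 2)
            + + 2 * (+ n - + 1) * q (n ∸ 2)
            + + 2 * + n * r (n ∸ 1)
            + + 2 * (+ 3 - + n) * r (n ∸ 2)
            - + 4 * r (n ∸ 3)
            + (+ n - + 1) ^ 2
            + ∑ 3 (n ∸ 2) (λ i →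
                q (i ∸ 1) * (a (n ∸ i) - a (n ∸ i ∸ 1)))
            + ∑ 3 (n ∸ 2) (λ i →
                (A (i ∸ 1) + (+ 2 * + i - + 1) * q (i ∸ 1) + (+ i) ^ 2)
                  * (r (n ∸ i) - r (n ∸ i ∸ 1)))
    a-recurrence m = begin
      a (4 ℕ.+ m)
        ≡⟨ a-diff (2 ℕ.+ m) ⟩
      _
        ≡⟨ cong₂ (λ x y → a (3 ℕ.+ m) + ((a (3 ℕ.+ m) - a (2 ℕ.+ m)) + w + x + (a (3 ℕ.+ m) + y)))
             (trans (Tr-ends m)
               (cong₂ (λ x y → x * (r (3 ℕ.+ m) - r (2 ℕ.+ m)) + (y * (r (2 ℕ.+ m) - r (1 ℕ.+ m))
                 + (Σr + T (2 ℕ.+ m) * 1ℤ + T (3 ℕ.+ m) * 0ℤ))) T0 T1))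
             (qa-ends m) ⟩
      _
        ≡⟨ lemma (+ m) (a (3 ℕ.+ m)) (a (2 ℕ.+ m)) (a (1 ℕ.+ m)) (r (3 ℕ.+ m)) (r (2 ℕ.+ m)) (r (1 ℕ.+ m))
             (A (2 ℕ.+ m)) (q (2 ℕ.+ m)) (T (3 ℕ.+ m)) (q (3 ℕ.+ m)) Σa Σr ⟩
      L + Σa + Σr
        ≡⟨ cong₂ (λ x y → L + x + y) (qa-sum m) (Tr-sum m) ⟨
      _ ∎
      where
      open ≡-Reasoning
      w  = (+ 2 * + (3 ℕ.+ m) + 1ℤ) * r (3 ℕ.+ m) - (+ 2 * + (2 ℕ.+ m) + 1ℤ) * r (2 ℕ.+ m)
      Σr = Σ< m (λ k → T (2 ℕ.+ k) * Δ (drop₀ r) (suc (m ∸ k)))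
      Σa = Σ< m (λ k → q (2 ℕ.+ k) * (a (suc (m ∸ k)) - a (m ∸ k)))
      L  = + 3 * a (3 ℕ.+ m) - a (2 ℕ.+ m) + A (2 ℕ.+ m)
            + + 2 * (+ (4 ℕ.+ m) - + 1) * q (2 ℕ.+ m)
            + + 2 * + (4 ℕ.+ m) * r (3 ℕ.+ m)
            + + 2 * (+ 3 - + (4 ℕ.+ m)) * r (2 ℕ.+ m)
            - + 4 * r (1 ℕ.+ m)
            + (+ (4 ℕ.+ m) - + 1) ^ 2
      T0 : T 0 ≡ 1ℤ
      T0 = cong₂ (λ x y → (0ℤ + x) + 1ℤ * (1ℤ + y)) A0 q0
      T1 : T 1 ≡ + 4
      T1 = cong₂ (λ x y → (1ℤ + x) + + 3 * (1ℤ + y)) A1 q1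
      lemma : ∀ m a3 a2 a1 r3 r2 r1 A2 q2 T3 q3 Σa Σr →
        a3 + ((a3 - a2) + ((+ 2 * (+ 3 + m) + + 1) * r3 - (+ 2 * (+ 2 + m) + + 1) * r2)
          + (+ 1 * (r3 - r2) + (+ 4 * (r2 - r1)
             + (Σr + (((+ 2 + m) * (+ 2 + m) + A2) + (+ 2 * (+ 2 + m) + + 1) * (+ 1 + q2)) * + 1
                + T3 * + 0)))
          + (a3 + (+ 0 * (a3 - a2) + (+ 0 * (a2 - a1) + (Σa + q2 * + 1 + q3 * + 0)))))
        ≡ + 3 * a3 - a2 + A2 + + 2 * ((+ 4 + m) - + 1) * q2 + + 2 * (+ 4 + m) * r3
          + + 2 * (+ 3 - (+ 4 + m)) * r2 - + 4 * r1
          + ((+ 4 + m) - + 1) * (((+ 4 + m) - + 1) * + 1) + Σa + Σr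
      lemma = solve-∀

-- Lists enumerating a predicate

-- xs lists the elements satisfying P, each exactly once.  Two such lists are
-- permutations of each other, so that counts and total areas may be computed
-- on either.
record Enumerates {X : Set} (xs : List X) (P : X → Set) : Set where
  field
    unique   : Unique xs
    sound    : ∀ {x} → x ∈ xs → P x
    complete : ∀ {x} → P x → x ∈ xs

open Enumerates

enum-↭ : ∀ {X : Set} {xs ys : List X} {P} → Enumerates xs P → Enumerates ys P → xs ↭ ys
enum-↭ e e′ = ∼bag⇒↭ (unique∧set⇒bag (unique e) (unique e′)
  (mk⇔ (complete e′ ∘ sound e) (complete e ∘ sound e′)))

enum-resp : ∀ {X : Set} {xs : List X} {P P′ : X → Set} →
  (∀ {x} → P x → P′ x) → (∀ {x} → P′ x → P x) → Enumerates xs P → Enumerates xs P′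
enum-resp to from e = record
  { unique = unique e ; sound = to ∘ sound e ; complete = complete e ∘ from }

enum-∷ : ∀ {X : Set} {x₀ : X} {xs P} → (∀ {x} → P x → x₀ ≢ x) →
  Enumerates xs P → Enumerates (x₀ ∷ xs) (λ x → x ≡ x₀ ⊎ P x)
enum-∷ x₀∉P e = record
  { unique   = All.tabulate (x₀∉P ∘ sound e) ∷ unique e
  ; sound    = λ { (here x≡x₀) → inj₁ x≡x₀ ; (there x∈xs) → inj₂ (sound e x∈xs) }
  ; complete = λ { (inj₁ x≡x₀) → here x≡x₀ ; (inj₂ p) → there (complete e p) }
  }

enum-++ : ∀ {X : Set} {xs ys : List X} {P P′} → (∀ {x} → P x → P′ x → ⊥) →
  Enumerates xs P → Enumerates ys P′ → Enumerates (xs ++ ys) (λ x → P x ⊎ P′ x)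
enum-++ {xs = xs} {ys} {P} {P′} disjoint e e′ = record
  { unique   = Unique.++⁺ (unique e) (unique e′)
                 λ (x∈xs , x∈ys) → disjoint (sound e x∈xs) (sound e′ x∈ys)
  ; sound    = s
  ; complete = λ { (inj₁ p) → ∈-++⁺ˡ (complete e p) ; (inj₂ p) → ∈-++⁺ʳ xs (complete e′ p) }
  }
  where
  s : ∀ {x} → x ∈ xs ++ ys → P x ⊎ P′ x
  s x∈ with ∈-++⁻ xs x∈
  ... | inj₁ x∈xs = inj₁ (sound e x∈xs)
  ... | inj₂ x∈ys = inj₂ (sound e′ x∈ys)

enum-map : ∀ {X Y : Set} {f : X → Y} {xs P} → (∀ {x x′} → f x ≡ f x′ → x ≡ x′) →
  Enumerates xs P → Enumerates (map f xs) (λ y → ∃ λ x → P x × y ≡ f x)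
enum-map {f = f} injective e = record
  { unique   = Unique.map⁺ injective (unique e)
  ; sound    = λ y∈ → let x , x∈xs , y≡ = ∈-map⁻ f y∈ in x , sound e x∈xs , y≡
  ; complete = λ { (x , p , refl) → ∈-map⁺ f (complete e p) }
  }

enum-product : ∀ {X Y Z : Set} {f : X → Y → Z} {xs ys P P′} →
  (∀ {w x y z} → f w y ≡ f x z → w ≡ x × y ≡ z) →
  Enumerates xs P → Enumerates ys P′ →
  Enumerates (cartesianProductWith f xs ys) (λ z → ∃₂ λ x y → P x × P′ y × z ≡ f x y)
enum-product {f = f} {xs} {ys} injective e e′ = record
  { unique   = Unique.cartesianProductWith⁺ f injective (unique e) (unique e′)
  ; sound    = λ z∈ → let x , y , x∈xs , y∈ys , z≡ = ∈-cartesianProductWith⁻ f xs ys z∈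
                      in x , y , sound e x∈xs , sound e′ y∈ys , z≡
  ; complete = λ { (x , y , p , p′ , refl) →
                   ∈-cartesianProductWith⁺ f (complete e p) (complete e′ p′) }
  }

enum-words : ∀ m → Enumerates (words m) (λ p → length p ≡ m)
enum-words zero = record
  { unique   = [] ∷ []
  ; sound    = λ { (here refl) → refl }
  ; complete = λ { {[]} refl → here refl }
  }
enum-words (suc m) = enum-resp to from
  (enum-product ∷-injective enum-steps (enum-words m))
  where
  enum-steps : Enumerates (U ∷ D ∷ []) (λ _ → ⊤)
  enum-steps = record
    { unique   = ((λ ()) ∷ []) ∷ [] ∷ []
    ; sound    = λ _ → _
    ; complete = λ { {U} _ → here refl ; {D} _ → there (here refl) }
    }
  to : ∀ {p} → (∃₂ λ x p′ → ⊤ × length p′ ≡ m × p ≡ x ∷ p′) → length p ≡ suc m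
  to (x , p′ , _ , eq , refl) = cong suc eq
  from : ∀ {p} → length p ≡ suc m → ∃₂ λ x p′ → ⊤ × length p′ ≡ m × p ≡ x ∷ p′
  from {x ∷ p′} eq = x , p′ , _ , ℕ.suc-injective eq , refl

-- Dyck paths as binary trees

-- A Dyck path is empty or, split at its first return to the axis, U p D p′ with
-- Dyck paths p and p′: the tree node s t stands for such a path.
data Tree : Set where
  leaf : Tree
  node : Tree → Tree → Tree

node-injective : ∀ {s s′ t t′} → node s t ≡ node s′ t′ → s ≡ s′ × t ≡ t′
node-injective refl = refl , refl

size : Tree → ℕ
size leaf       = 0
size (node s t) = suc (size s ℕ.+ size t)

word : Tree → Path
word leaf       = []
word (node s t) = U ∷ word s ++ D ∷ word t

-- The levels of the valleys of word t; those of the first subtree are raised by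
-- one in the whole path.  A valley at the first return is present
-- unless the second subtree is empty.
levels : Tree → List ℕ
levels leaf                    = []
levels (node s leaf)           = map suc (levels s)
levels (node s t@(node _ _))   = map suc (levels s) ++ 0 ∷ levels t

-- The area of the path word t, and the area of U (word t) D: raising the
-- 2 n + 1 points of a path of semi-length n by one adds 2 n + 1.
treeArea liftedArea : Tree → ℤ
treeArea leaf       = 0ℤ
treeArea (node s t) = liftedArea s + treeArea t
liftedArea s = treeArea s + (+ 2 * + size s + 1ℤ)

word-node : ∀ s t p → word (node s t) ++ p ≡ U ∷ word s ++ D ∷ (word t ++ p)
word-node s t p = cong (U ∷_) (++-assoc (word s) (D ∷ word t) p)

length-word : ∀ t → length (word t) ≡ 2 ℕ.* size t
length-word leaf = refl
length-word (node s t) = begin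
  suc (length (word s ++ D ∷ word t))
    ≡⟨ cong suc (length-++ (word s)) ⟩
  suc (length (word s) ℕ.+ suc (length (word t)))
    ≡⟨ cong₂ (λ x y → suc (x ℕ.+ suc y)) (length-word s) (length-word t) ⟩
  suc (2 ℕ.* size s ℕ.+ suc (2 ℕ.* size t))
    ≡⟨ lemma (size s) (size t) ⟩
  2 ℕ.* suc (size s ℕ.+ size t) ∎
  where
  open ≡-Reasoning
  lemma : ∀ m n → suc (2 ℕ.* m ℕ.+ suc (2 ℕ.* n)) ≡ 2 ℕ.* suc (m ℕ.+ n)
  lemma = ℕ-Solver.solve-∀

semilength-word++ : ∀ t p → semilength (word t ++ p) ≡ size t ℕ.+ semilength p
semilength-word++ leaf p = refl
semilength-word++ (node s t) p = begin
  semilength (word (node s t) ++ p)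
    ≡⟨ cong semilength (word-node s t p) ⟩
  suc (semilength (word s ++ D ∷ (word t ++ p)))
    ≡⟨ cong suc (semilength-word++ s (D ∷ (word t ++ p))) ⟩
  suc (size s ℕ.+ semilength (word t ++ p))
    ≡⟨ cong (λ x → suc (size s ℕ.+ x)) (semilength-word++ t p) ⟩
  suc (size s ℕ.+ (size t ℕ.+ semilength p))
    ≡⟨ cong suc (ℕ.+-assoc (size s) (size t) (semilength p)) ⟨
  suc (size s ℕ.+ size t) ℕ.+ semilength p ∎
  where open ≡-Reasoning

semilength-word : ∀ t → semilength (word t) ≡ size t
semilength-word t = trans (cong semilength (sym (++-identityʳ (word t))))
  (trans (semilength-word++ t []) (ℕ.+-identityʳ (size t)))

-- The paths not starting with U.  Followed by such a path, word t is delimited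
-- uniquely, and no valley straddles the junction.
data NotUp : Path → Set where
  []   : NotUp []
  down : ∀ {p} → NotUp (D ∷ p)

word++-injective : ∀ s t {p p′} → NotUp p → NotUp p′ →
  word s ++ p ≡ word t ++ p′ → s ≡ t × p ≡ p′
word++-injective leaf         leaf         _  _  eq = refl , eq
word++-injective leaf         (node t₁ t₂) [] _  ()
word++-injective leaf         (node t₁ t₂) down _ ()
word++-injective (node s₁ s₂) leaf         _ [] ()
word++-injective (node s₁ s₂) leaf         _ down ()
word++-injective (node s₁ s₂) (node t₁ t₂) {p} {p′} d d′ eq
  with word++-injective s₁ t₁ down down
         (∷-injectiveʳ (trans (sym (word-node s₁ s₂ p)) (trans eq (word-node t₁ t₂ p′))))
... | refl , eq₂ with word++-injective s₂ t₂ d d′ (∷-injectiveʳ eq₂)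
...   | refl , eq₃ = refl , eq₃

word-injective : ∀ {s t} → word s ≡ word t → s ≡ t
word-injective {s} {t} eq =
  proj₁ (word++-injective s t [] [] (cong (_++ []) eq))

up : ∀ y → + y + 1ℤ ≡ + suc y
up y = cong +_ (ℕ.+-comm y 1)

last-∷-heights : ∀ x y p → last (x ∷ heights y p) ≡ last (heights y p)
last-∷-heights x y []      = refl
last-∷-heights x y (U ∷ p) = refl
last-∷-heights x y (D ∷ p) = refl

heights-word-≥0 : ∀ y t p → All (0ℤ ≤_) (heights (+ y) p) → All (0ℤ ≤_) (heights (+ y) (word t ++ p))
heights-word-≥0 y leaf       p ≥0 = ≥0
heights-word-≥0 y (node s t) p ≥0 rewrite ++-assoc (word s) (D ∷ word t) p | up y =
  +≤+ z≤n ∷ heights-word-≥0 (suc y) s _ (+≤+ z≤n ∷ heights-word-≥0 y t p ≥0)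

last-heights-word : ∀ y t p → last (heights (+ y) (word t ++ p)) ≡ last (heights (+ y) p)
last-heights-word y leaf       p = refl
last-heights-word y (node s t) p rewrite ++-assoc (word s) (D ∷ word t) p | up y = begin
  last (+ y ∷ heights (+ suc y) (word s ++ D ∷ (word t ++ p)))
    ≡⟨ last-∷-heights (+ y) (+ suc y) (word s ++ D ∷ (word t ++ p)) ⟩
  last (heights (+ suc y) (word s ++ D ∷ (word t ++ p)))
    ≡⟨ last-heights-word (suc y) s _ ⟩
  last (+ suc y ∷ heights (+ y) (word t ++ p))
    ≡⟨ last-∷-heights (+ suc y) (+ y) (word t ++ p) ⟩
  last (heights (+ y) (word t ++ p))
    ≡⟨ last-heights-word y t p ⟩
  last (heights (+ y) p) ∎
  where open ≡-Reasoning

isDyck-word : ∀ t → IsDyck (word t)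
isDyck-word t = subst IsDyck (++-identityʳ (word t))
  (heights-word-≥0 0 t [] (+≤+ z≤n ∷ []) , last-heights-word 0 t [])

-- Started at height y, the path word t has each of its 2 n points before the last
-- raised by y; the last is the first point of p and is counted there.
sum-heights-word : ∀ y t p →
  sumℤ (heights (+ y) (word t ++ p)) ≡
  treeArea t + + 2 * + size t * + y + sumℤ (heights (+ y) p)
sum-heights-word y leaf p = sym (ℤ.+-identityˡ _)
sum-heights-word y (node s t) p rewrite ++-assoc (word s) (D ∷ word t) p | up y = begin
  + y + sumℤ (heights (+ suc y) (word s ++ D ∷ (word t ++ p)))
    ≡⟨ cong (λ x → + y + x) (sum-heights-word (suc y) s _) ⟩
  + y + (treeArea s + + 2 * + size s * + suc y + (+ suc y + sumℤ (heights (+ y) (word t ++ p))))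
    ≡⟨ cong (λ x → + y + (treeArea s + + 2 * + size s * + suc y + (+ suc y + x))) (sum-heights-word y t p) ⟩
  _
    ≡⟨ lemma (+ y) (treeArea s) (treeArea t) (+ size s) (+ size t) _ ⟩
  _ ∎
  where
  open ≡-Reasoning
  lemma : ∀ y s t m n h →
    y + (s + + 2 * m * (+ 1 + y) + ((+ 1 + y) + (t + + 2 * n * y + h)))
    ≡ (s + (+ 2 * m + + 1)) + t + + 2 * (+ 1 + (m + n)) * y + h
  lemma = solve-∀

area-word : ∀ t → area (word t) ≡ treeArea t
area-word t = begin
  area (word t)
    ≡⟨ cong area (++-identityʳ (word t)) ⟨
  area (word t ++ [])
    ≡⟨ sum-heights-word 0 t [] ⟩
  treeArea t + + 2 * + size t * 0ℤ + 0ℤ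
    ≡⟨ lemma (treeArea t) (+ size t) ⟩
  treeArea t ∎
  where
  open ≡-Reasoning
  lemma : ∀ a b → a + + 2 * b * 0ℤ + 0ℤ ≡ a
  lemma = solve-∀

valleysFrom-word : ∀ y t {p} → NotUp p →
  valleysFrom (+ y) (word t ++ p) ≡ map (λ l → + (y ℕ.+ l)) (levels t) ++ valleysFrom (+ y) p
valleysFrom-word y leaf _ = refl
valleysFrom-word y (node s t) {p} d rewrite ++-assoc (word s) (D ∷ word t) p | up y = begin
  valleysFrom (+ suc y) (word s ++ D ∷ (word t ++ p))
    ≡⟨ valleysFrom-word (suc y) s down ⟩
  map (λ l → + (suc y ℕ.+ l)) (levels s) ++ valleysFrom (+ suc y) (D ∷ (word t ++ p))
    ≡⟨ cong (_++ valleysFrom (+ suc y) (D ∷ (word t ++ p)))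
         (trans (map-cong (λ l → cong +_ (sym (ℕ.+-suc y l))) (levels s)) (map-∘ (levels s))) ⟩
  map (λ l → + (y ℕ.+ l)) (map suc (levels s)) ++ valleysFrom (+ suc y) (D ∷ (word t ++ p))
    ≡⟨ descend t d ⟩
  map (λ l → + (y ℕ.+ l)) (levels (node s t)) ++ valleysFrom (+ y) p ∎
  where
  open ≡-Reasoning
  descend : ∀ t {p} → NotUp p →
    map (λ l → + (y ℕ.+ l)) (map suc (levels s)) ++ valleysFrom (+ suc y) (D ∷ (word t ++ p))
    ≡ map (λ l → + (y ℕ.+ l)) (levels (node s t)) ++ valleysFrom (+ y) p
  descend leaf []   = refl
  descend leaf down = refl
  descend t@(node _ _) {p} d = begin
    map at ls ++ + y ∷ valleysFrom (+ y) (word t ++ p)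
      ≡⟨ cong₂ (λ x xs → map at ls ++ + x ∷ xs) (sym (ℕ.+-identityʳ y)) (valleysFrom-word y t d) ⟩
    map at ls ++ map at (0 ∷ levels t) ++ valleysFrom (+ y) p
      ≡⟨ ++-assoc (map at ls) _ _ ⟨
    (map at ls ++ map at (0 ∷ levels t)) ++ valleysFrom (+ y) p
      ≡⟨ cong (_++ valleysFrom (+ y) p) (map-++ at ls (0 ∷ levels t)) ⟨
    map at (ls ++ 0 ∷ levels t) ++ valleysFrom (+ y) p ∎
    where
    at : ℕ → ℤ
    at l = + (y ℕ.+ l)
    ls = map suc (levels s)

valleys-word : ∀ t → valleys (word t) ≡ map +_ (levels t)
valleys-word t = begin
  valleys (word t)                       ≡⟨ cong valleys (++-identityʳ (word t)) ⟨
  valleys (word t ++ [])                 ≡⟨ valleysFrom-word 0 t [] ⟩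
  map +_ (levels t) ++ []                ≡⟨ ++-identityʳ _ ⟩
  map +_ (levels t)                      ∎
  where open ≡-Reasoning

-- A path from height y to height 0 that stays nonnegative.
DyckFrom : ℕ → Path → Set
DyckFrom y p = All (0ℤ ≤_) (heights (+ y) p) × last (heights (+ y) p) ≡ just 0ℤ

-- Such a path reads t₀ D t₁ D ⋯ D t_y for Dyck paths t₀, …, t_y, where each
-- displayed D is the first descent below the current height.
join : ∀ {y} → Tree → Vec Tree y → Path
join t []       = word t
join t (u ∷ us) = word t ++ D ∷ join u us

join-node : ∀ {y} s t (us : Vec Tree y) → U ∷ word s ++ D ∷ join t us ≡ join (node s t) us
join-node s t []       = refl
join-node s t (u ∷ us) = sym (word-node s t (D ∷ join u us))

-- A leading U merges the first two of these Dyck paths into a single node.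
parse : ∀ y p → DyckFrom y p → ∃₂ λ t (us : Vec Tree y) → p ≡ join t us
parse zero    []      _          = leaf , [] , refl
parse (suc y) []      (_ , ())
parse zero    (D ∷ p) (_ ∷ ≥0 , _) = ⊥-elim (0≰-1 (first p ≥0))
  where
  first : ∀ p → All (0ℤ ≤_) (heights -1ℤ p) → 0ℤ ≤ -1ℤ
  first []      (≥0 ∷ _) = ≥0
  first (U ∷ _) (≥0 ∷ _) = ≥0
  first (D ∷ _) (≥0 ∷ _) = ≥0
  0≰-1 : ¬ 0ℤ ≤ -1ℤ
  0≰-1 ()
parse (suc y) (D ∷ p) (_ ∷ ≥0 , end) =
  let t , us , eq = parse y p (≥0 , trans (sym (last-∷-heights (+ suc y) (+ y) p)) end)
  in leaf , t ∷ us , cong (D ∷_) eq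
parse y (U ∷ p) (_ ∷ ≥0 , end) with parse (suc y) p
  ( subst (λ h → All (0ℤ ≤_) (heights h p)) (up y) ≥0
  , trans (sym (last-∷-heights (+ y) (+ suc y) p))
      (subst (λ h → last (+ y ∷ heights h p) ≡ just 0ℤ) (up y) end) )
... | s , t ∷ us , refl = node s t , us , join-node s t us

isDyck⇒word : ∀ {p} → IsDyck p → ∃ λ t → p ≡ word t
isDyck⇒word {p} dyck with parse 0 p dyck
... | t , [] , eq = t , eq

-- The valley conditions on trees

-- The condition ν′ - ν ≥ -1 for consecutive valley levels.
_≼_ : ℕ → ℕ → Set
l ≼ l′ = l ℕ.≤ suc l′

-- RTree: the (-1)-Dyck condition.  QTree: moreover the last valley exists and is
-- at ground level.  STree: moreover there is no valley or the last is at ground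
-- level; these are the trees that may precede a valley at the first return.
RTree QTree STree : Tree → Set
RTree t = Linked _≼_ (levels t)
QTree t = RTree t × last (levels t) ≡ just 0

-- The last of the levels, if any, is 0.
Low : List ℕ → Set
Low ls = last ls ≡ nothing ⊎ last ls ≡ just 0

STree t = RTree t × Low (levels t)

-- P restricted to the trees of size n.
Graded : (Tree → Set) → ℕ → Tree → Set
Graded P n t = size t ≡ n × P t

graded-injective : ∀ P {i j t} → Graded P i t → Graded P j t → i ≡ j
graded-injective P (sz , _) (sz′ , _) = trans (sym sz) sz′

≼⇒ℤ : ∀ {l l′} → l ≼ l′ → -1ℤ ≤ + l′ - + l
≼⇒ℤ {l} {l′} l≼l′ =
  subst₂ _≤_ (e₁ (+ l)) (e₂ (+ l) (+ l′)) (ℤ.+-monoˡ-≤ (- + l - 1ℤ) (+≤+ l≼l′))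
  where
  e₁ : ∀ x → x + (- x - 1ℤ) ≡ -1ℤ
  e₁ = solve-∀
  e₂ : ∀ x y → (1ℤ + y) + (- x - 1ℤ) ≡ y - x
  e₂ = solve-∀

ℤ⇒≼ : ∀ {l l′} → -1ℤ ≤ + l′ - + l → l ≼ l′
ℤ⇒≼ {l} {l′} h = ℤ.drop‿+≤+
  (subst₂ _≤_ (e₁ (+ l)) (e₂ (+ l) (+ l′)) (ℤ.+-monoˡ-≤ (+ l + 1ℤ) h))
  where
  e₁ : ∀ x → -1ℤ + (x + 1ℤ) ≡ x
  e₁ = solve-∀
  e₂ : ∀ x y → (y - x) + (x + 1ℤ) ≡ 1ℤ + y
  e₂ = solve-∀

R-word⁻ : ∀ n t → R n (word t) → Graded RTree n t
R-word⁻ n t (len , _ , linked) = trans (sym (semilength-word t)) len ,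
  Linked.map ℤ⇒≼ (Linked.map⁻ (subst (Linked _) (valleys-word t) linked))

R-word⁺ : ∀ n t → Graded RTree n t → R n (word t)
R-word⁺ n t (sz , linked) = trans (semilength-word t) sz , isDyck-word t ,
  subst (Linked _) (sym (valleys-word t)) (Linked.map⁺ (Linked.map ≼⇒ℤ linked))

last-valley : ∀ t → last (valleys (word t)) ≡ Maybe.map (λ l → + l) (last (levels t))
last-valley t = trans (cong last (valleys-word t)) (last-map _ (levels t))

Q-word⁻ : ∀ n t → Q n (word t) → Graded QTree n t
Q-word⁻ n t (rn , ground) = let sz , rt = R-word⁻ n t rn in
  sz , rt , Maybe.map-injective ℤ.+-injective (trans (sym (last-valley t)) ground)

Q-word⁺ : ∀ n t → Graded QTree n t → Q n (word t)
Q-word⁺ n t (sz , rt , ground) = R-word⁺ n t (sz , rt) ,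
  trans (last-valley t) (cong (Maybe.map (λ l → + l)) ground)

linked-suc⁺ : ∀ {ls} → Linked _≼_ ls → Linked _≼_ (map suc ls)
linked-suc⁺ = Linked.map⁺ ∘ Linked.map s≤s

linked-suc⁻ : ∀ {ls} → Linked _≼_ (map suc ls) → Linked _≼_ ls
linked-suc⁻ = Linked.map ℕ.s≤s⁻¹ ∘ Linked.map⁻

-- A valley at level 0 may only follow one at level at most 1, so the raised path
-- before it must have had its last valley, if any, at level 0; after a valley at
-- level 0 any level is allowed.
linked-join⁺ : ∀ {ls ls′} → Linked _≼_ ls → Low ls → Linked _≼_ ls′ →
  Linked _≼_ (map suc ls ++ 0 ∷ ls′)
linked-join⁺ {[]}     {[]}    _ _ _       = [-]
linked-join⁺ {[]}     {_ ∷ _} _ _ l       = z≤n ∷ l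
linked-join⁺ {_ ∷ []} _ (inj₂ refl) l     = s≤s z≤n ∷ linked-join⁺ {[]} [] (inj₁ refl) l
linked-join⁺ {_ ∷ _ ∷ _} (x ∷ xs) low l   = s≤s x ∷ linked-join⁺ xs low l

linked-join⁻ : ∀ ls {ls′} → Linked _≼_ (map suc ls ++ 0 ∷ ls′) →
  Linked _≼_ ls × Low ls × Linked _≼_ ls′
linked-join⁻ []          l       = [] , inj₁ refl , Linked.tail l
linked-join⁻ (zero ∷ []) (_ ∷ l) = [-] , inj₂ refl , Linked.tail l
linked-join⁻ (suc _ ∷ []) (s≤s () ∷ _)
linked-join⁻ (_ ∷ ls@(_ ∷ _)) (x ∷ l) =
  let xs , low , l′ = linked-join⁻ ls l in ℕ.s≤s⁻¹ x ∷ xs , low , l′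

last-++-∷ : ∀ {X : Set} xs (y : X) ys → last (xs ++ y ∷ ys) ≡ last (y ∷ ys)
last-++-∷ []            y ys = refl
last-++-∷ (_ ∷ [])      y ys = refl
last-++-∷ (_ ∷ x ∷ xs)  y ys = last-++-∷ (x ∷ xs) y ys

low⁺ : ∀ ls → Low ls → last (0 ∷ ls) ≡ just 0
low⁺ []      _           = refl
low⁺ (x ∷ ls) (inj₂ eq)  = eq
low⁺ (x ∷ []) (inj₁ ())
low⁺ (x ∷ y ∷ ls) (inj₁ eq) = ⊥-elim (last≢nothing y ls eq)
  where
  last≢nothing : ∀ {X : Set} (x : X) xs → last (x ∷ xs) ≢ nothing
  last≢nothing x (y ∷ xs) = last≢nothing y xs

low⁻ : ∀ ls → last (0 ∷ ls) ≡ just 0 → Low ls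
low⁻ []       _  = inj₁ refl
low⁻ (x ∷ ls) eq = inj₂ eq

-- The tree of Uⁿ Dⁿ.
pyramid : ℕ → Tree
pyramid zero    = leaf
pyramid (suc n) = node (pyramid n) leaf

size-pyramid : ∀ n → size (pyramid n) ≡ n
size-pyramid zero    = refl
size-pyramid (suc n) = cong suc (trans (ℕ.+-identityʳ _) (size-pyramid n))

levels-pyramid : ∀ n → levels (pyramid n) ≡ []
levels-pyramid zero    = refl
levels-pyramid (suc n) = cong (map suc) (levels-pyramid n)

area-pyramid : ∀ n → treeArea (pyramid n) ≡ + n * + n
area-pyramid zero    = refl
area-pyramid (suc n) = trans
  (cong₂ (λ x y → (x + (+ 2 * + y + 1ℤ)) + 0ℤ) (area-pyramid n) (size-pyramid n))
  (lemma (+ n))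
  where
  lemma : ∀ n → (n * n + (+ 2 * n + + 1)) + + 0 ≡ (+ 1 + n) * (+ 1 + n)
  lemma = solve-∀

no-valley⇒pyramid : ∀ t → last (levels t) ≡ nothing → t ≡ pyramid (size t)
no-valley⇒pyramid leaf _ = refl
no-valley⇒pyramid (node s leaf) eq = trans
  (cong (λ s → node s leaf)
    (no-valley⇒pyramid s (map⁻ (last (levels s)) (trans (sym (last-map _ (levels s))) eq))))
  (cong (λ n → node (pyramid n) leaf) (sym (ℕ.+-identityʳ (size s))))
  where
  map⁻ : ∀ (x : Maybe ℕ) → Maybe.map suc x ≡ nothing → x ≡ nothing
  map⁻ nothing _ = refl
no-valley⇒pyramid (node s t@(node _ _)) eq =
  ⊥-elim (nonempty (map suc (levels s)) eq)
  where
  nonempty : ∀ xs {y ys} → last {A = ℕ} (xs ++ y ∷ ys) ≢ nothing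
  nonempty []               {ys = z ∷ ys} = nonempty [] {z} {ys}
  nonempty (_ ∷ [])         {y} {ys}  = nonempty [] {y} {ys}
  nonempty (_ ∷ x ∷ xs)               = nonempty (x ∷ xs)

STree⁺ : ∀ {n t} → t ≡ pyramid n ⊎ Graded QTree n t → Graded STree n t
STree⁺ {n} (inj₁ refl) rewrite levels-pyramid n = size-pyramid n , [] , inj₁ refl
STree⁺ (inj₂ (sz , rt , low)) = sz , rt , inj₂ low

STree⁻ : ∀ {n t} → Graded STree n t → t ≡ pyramid n ⊎ Graded QTree n t
STree⁻ {t = t} (refl , rt , inj₁ none) = inj₁ (no-valley⇒pyramid t none)
STree⁻ (sz , rt , inj₂ low)  = inj₂ (sz , rt , low)

RTree-node⁺ : ∀ {s t} → STree s → RTree t → t ≢ leaf → RTree (node s t)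
RTree-node⁺ {t = leaf}     _            _  t≢leaf = ⊥-elim (t≢leaf refl)
RTree-node⁺ {t = node _ _} (rs , low) rt _      = linked-join⁺ rs low rt

QTree-node⁺ : ∀ {s t} → STree s → STree t → t ≢ leaf → QTree (node s t)
QTree-node⁺ {t = leaf} _ _ t≢leaf = ⊥-elim (t≢leaf refl)
QTree-node⁺ {s} {t@(node _ _)} Ss (rt , low) t≢leaf = RTree-node⁺ {s} {t} Ss rt t≢leaf ,
  trans (last-++-∷ (map suc (levels s)) 0 (levels t)) (low⁺ (levels t) low)

QTree-node⁻ : ∀ s t → QTree (node s t) → STree s × STree t × t ≢ leaf
QTree-node⁻ s leaf (_ , low) = ⊥-elim (suc≢0 (last (levels s)) (trans (sym (last-map _ (levels s))) low))
  where
  suc≢0 : ∀ x → Maybe.map suc x ≢ just 0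
  suc≢0 (just _) ()
  suc≢0 nothing ()
QTree-node⁻ s t@(node _ _) (linked , low) =
  let rs , lows , rt = linked-join⁻ (levels s) linked
  in (rs , lows) ,
     (rt , low⁻ (levels t) (trans (sym (last-++-∷ (map suc (levels s)) 0 (levels t))) low)) ,
     λ ()

-- Sums of weights over trees split at the root

-- All trees node s t with s in F i and t in G j for some i + j = n.
nodes : (ℕ → List Tree) → (ℕ → List Tree) → ℕ → List Tree
nodes F G zero    = cartesianProductWith node (F 0) (G 0)
nodes F G (suc n) = cartesianProductWith node (F 0) (G (suc n)) ++ nodes (F ∘ suc) G n

-- The predicate enumerated by nodes.
Nodes : (P P′ : ℕ → Tree → Set) → ℕ → Tree → Set
Nodes P P′ n u = ∃₂ λ s t → (∃₂ λ i j → i ℕ.+ j ≡ n × P i s × P′ j t) × u ≡ node s t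

-- Unless the classes P i are disjoint, a tree could occur for several i.
enum-nodes : ∀ {F G} {P P′ : ℕ → Tree → Set} →
  (∀ {i j s} → P i s → P j s → i ≡ j) →
  (∀ i → Enumerates (F i) (P i)) → (∀ j → Enumerates (G j) (P′ j)) →
  ∀ n → Enumerates (nodes F G n) (Nodes P P′ n)
enum-nodes {P = P} {P′} graded eF eG zero = enum-resp to from
  (enum-product node-injective (eF 0) (eG 0))
  where
  to : ∀ {u} → (∃₂ λ s t → P 0 s × P′ 0 t × u ≡ node s t) → Nodes P P′ 0 u
  to (s , t , p , p′ , eq) = s , t , (0 , 0 , refl , p , p′) , eq
  from : ∀ {u} → Nodes P P′ 0 u → ∃₂ λ s t → P 0 s × P′ 0 t × u ≡ node s t
  from (s , t , (zero , zero , refl , p , p′) , eq) = s , t , p , p′ , eq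
enum-nodes {P = P} {P′} graded eF eG (suc n) = enum-resp to from
  (enum-++ disjoint (enum-product node-injective (eF 0) (eG (suc n)))
    (enum-nodes (λ p p′ → ℕ.suc-injective (graded p p′)) (eF ∘ suc) eG n))
  where
  Head : Tree → Set
  Head u = ∃₂ λ s t → P 0 s × P′ (suc n) t × u ≡ node s t
  disjoint : ∀ {u} → Head u → Nodes (P ∘ suc) P′ n u → ⊥
  disjoint (s , t , p , _ , refl) (_ , _ , (_ , _ , _ , p′ , _) , refl) with graded p p′
  ... | ()
  to : ∀ {u} → Head u ⊎ Nodes (P ∘ suc) P′ n u → Nodes P P′ (suc n) u
  to (inj₁ (s , t , p , p′ , eq)) = s , t , (0 , suc n , refl , p , p′) , eq
  to (inj₂ (s , t , (i , j , i+j , p , p′) , eq)) = s , t , (suc i , j , cong suc i+j , p , p′) , eq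
  from : ∀ {u} → Nodes P P′ (suc n) u → Head u ⊎ Nodes (P ∘ suc) P′ n u
  from (s , t , (zero , _ , refl , p , p′) , eq) = inj₁ (s , t , p , p′ , eq)
  from (s , t , (suc i , j , i+j , p , p′) , eq) =
    inj₂ (s , t , (i , j , ℕ.suc-injective i+j , p , p′) , eq)

-- The sum of f over a list.
weight : {X : Set} → (X → ℤ) → List X → ℤ
weight f xs = sumℤ (map f xs)

weight-cong : ∀ {X : Set} {f g : X → ℤ} → f ≗ g → weight f ≗ weight g
weight-cong f≗g xs = cong sumℤ (map-cong f≗g xs)

weight-++ : ∀ {X : Set} (f : X → ℤ) xs ys → weight f (xs ++ ys) ≡ weight f xs + weight f ys
weight-++ f []       ys = sym (ℤ.+-identityˡ _)
weight-++ f (x ∷ xs) ys = trans (cong (λ z → f x + z) (weight-++ f xs ys)) (sym (ℤ.+-assoc (f x) _ _))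

weight-↭ : ∀ {X : Set} (f : X → ℤ) {xs ys} → xs ↭ ys → weight f xs ≡ weight f ys
weight-↭ f ↭.refl          = refl
weight-↭ f (↭.prep x p)    = cong (λ z → f x + z) (weight-↭ f p)
weight-↭ f (↭.trans p p′)  = trans (weight-↭ f p) (weight-↭ f p′)
weight-↭ f (↭.swap {xs} {ys} x y p) = trans (cong (λ z → f x + (f y + z)) (weight-↭ f p))
  (lemma (f x) (f y) (weight f ys))
  where
  lemma : ∀ a b c → a + (b + c) ≡ b + (a + c)
  lemma = solve-∀

-- The weight that counts.
unit : {X : Set} → X → ℤ
unit _ = 1ℤ

weight-1 : ∀ {X : Set} (xs : List X) → + length xs ≡ weight unit xs
weight-1 []       = refl
weight-1 (x ∷ xs) = cong (λ z → 1ℤ + z) (weight-1 xs)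

weight-map : ∀ {X Y : Set} (f : Y → ℤ) (g : X → Y) xs → weight f (map g xs) ≡ weight (f ∘ g) xs
weight-map f g xs = cong sumℤ (sym (map-∘ xs))

weight-+ : ∀ {X : Set} (f g : X → ℤ) xs → weight (λ x → f x + g x) xs ≡ weight f xs + weight g xs
weight-+ f g []       = refl
weight-+ f g (x ∷ xs) = trans (cong (λ z → f x + g x + z) (weight-+ f g xs))
  (lemma (f x) (g x) (weight f xs) (weight g xs))
  where
  lemma : ∀ a b c d → a + b + (c + d) ≡ (a + c) + (b + d)
  lemma = solve-∀

weight-nodes-product : ∀ (f g h : Tree → ℤ) → (∀ s t → f (node s t) ≡ g s * h t) → ∀ ss ts →
  weight f (cartesianProductWith node ss ts) ≡ weight g ss * weight h ts
weight-nodes-product f g h f≡ []       ts = refl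
weight-nodes-product f g h f≡ (s ∷ ss) ts = begin
  weight f (map (node s) ts ++ cartesianProductWith node ss ts)
    ≡⟨ weight-++ f (map (node s) ts) _ ⟩
  weight f (map (node s) ts) + weight f (cartesianProductWith node ss ts)
    ≡⟨ cong₂ _+_ (scale ts) (weight-nodes-product f g h f≡ ss ts) ⟩
  g s * weight h ts + weight g ss * weight h ts
    ≡⟨ ℤ.*-distribʳ-+ (weight h ts) (g s) (weight g ss) ⟨
  weight g (s ∷ ss) * weight h ts ∎
  where
  open ≡-Reasoning
  scale : ∀ ts → weight f (map (node s) ts) ≡ g s * weight h ts
  scale []       = sym (ℤ.*-zeroʳ (g s))
  scale (t ∷ ts) = trans (cong₂ _+_ (f≡ s t) (scale ts)) (sym (ℤ.*-distribˡ-+ (g s) (h t) _))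

-- A weight that is multiplicative over the root turns nodes into a convolution.
weight-nodes : ∀ (f g h : Tree → ℤ) → (∀ s t → f (node s t) ≡ g s * h t) → ∀ F G n →
  weight f (nodes F G n) ≡ conv (weight g ∘ F) (weight h ∘ G) n
weight-nodes f g h f≡ F G zero = trans (weight-nodes-product f g h f≡ (F 0) (G 0)) (sym (ℤ.+-identityʳ _))
weight-nodes f g h f≡ F G (suc n) = trans (weight-++ f (cartesianProductWith node (F 0) (G (suc n))) _)
  (cong₂ _+_ (weight-nodes-product f g h f≡ (F 0) (G (suc n))) (weight-nodes f g h f≡ (F ∘ suc) G n))

-- The area is a sum of two multiplicative weights, one for each subtree.
area-nodes : ∀ F G n → weight treeArea (nodes F G n) ≡
  conv (weight liftedArea ∘ F) (weight unit ∘ G) n + conv (weight unit ∘ F) (weight treeArea ∘ G) n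
area-nodes F G n = begin
  weight treeArea us
    ≡⟨ weight-cong split us ⟩
  weight (λ u → left u + right u) us
    ≡⟨ weight-+ left right us ⟩
  weight left us + weight right us
    ≡⟨ cong₂ _+_ (weight-nodes left liftedArea unit (λ s _ → sym (ℤ.*-identityʳ _)) F G n)
                 (weight-nodes right unit treeArea (λ _ t → sym (ℤ.*-identityˡ _)) F G n) ⟩
  _ ∎
  where
  open ≡-Reasoning
  us = nodes F G n
  left right : Tree → ℤ
  left leaf        = 0ℤ
  left (node s t)  = liftedArea s
  right leaf       = 0ℤ
  right (node s t) = treeArea t
  split : ∀ u → treeArea u ≡ left u + right u
  split leaf       = refl
  split (node s t) = refl

weight-lifted : ∀ n ts → (∀ {t} → t ∈ ts → size t ≡ n) →
  weight liftedArea ts ≡ weight treeArea ts + (+ 2 * + n + 1ℤ) * weight unit ts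
weight-lifted n []       _  = sym (trans (ℤ.+-identityˡ _) (ℤ.*-zeroʳ (+ 2 * + n + 1ℤ)))
weight-lifted n (t ∷ ts) sz = trans
  (cong₂ (λ x y → (treeArea t + (+ 2 * + x + 1ℤ)) + y) (sz (here refl)) (weight-lifted n ts (sz ∘ there)))
  (lemma (treeArea t) (+ n) (weight treeArea ts) (weight unit ts))
  where
  lemma : ∀ a n w u → (a + (+ 2 * n + + 1)) + (w + (+ 2 * n + + 1) * u)
    ≡ (a + w) + (+ 2 * n + + 1) * (+ 1 + u)
  lemma = solve-∀

-- From paths to trees

-- A list of Dyck paths is the image of a list of trees.
enum-trees : ∀ {ps : List Path} {P : Path → Set} → (∀ {p} → P p → IsDyck p) →
  Enumerates ps P → ∃ λ ts → ps ≡ map word ts × Enumerates ts (P ∘ word)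
enum-trees {P = P} dyck e with trees (λ p∈ → isDyck⇒word (dyck (sound e p∈)))
  where
  trees : ∀ {ps} → (∀ {p} → p ∈ ps → ∃ λ t → p ≡ word t) → ∃ λ ts → ps ≡ map word ts
  trees {[]}     _ = [] , refl
  trees {p ∷ ps} h =
    let t , eq = h (here refl) ; ts , eqs = trees (h ∘ there) in t ∷ ts , cong₂ _∷_ eq eqs
... | ts , refl = ts , refl , record
  { unique   = Unique.map⁻ (unique e)
  ; sound    = sound e ∘ ∈-map⁺ word
  ; complete = λ p → let t , t∈ , eq = ∈-map⁻ word (complete e p)
                     in subst (_∈ ts) (sym (word-injective eq)) t∈
  }

length-Dyck : ∀ {n p} → R n p → length p ≡ 2 ℕ.* n
length-Dyck {p = p} (len , dyck , _) with isDyck⇒word dyck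
... | t , refl = trans (length-word t) (cong (2 ℕ.*_) (trans (sym (semilength-word t)) len))

enum-filter : ∀ {X : Set} {xs : List X} {P P′ : X → Set} (P′? : ∀ x → Dec (P′ x)) →
  (∀ {x} → P′ x → P x) → Enumerates xs P → Enumerates (filter P′? xs) P′
enum-filter {xs = xs} P′? P′⇒P e = record
  { unique   = Unique.filter⁺ P′? (unique e)
  ; sound    = λ x∈ → proj₂ (∈-filter⁻ P′? {xs = xs} x∈)
  ; complete = λ p → ∈-filter⁺ P′? (complete e (P′⇒P p)) p
  }

Rtrees-exist : ∀ n → ∃ λ ts → Rpaths n ≡ map word ts × Enumerates ts (Graded RTree n)
Rtrees-exist n =
  let ts , eq , e = enum-trees (λ (_ , dyck , _) → dyck)
                      (enum-filter (R? n) length-Dyck (enum-words (2 ℕ.* n)))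
  in ts , eq , enum-resp (R-word⁻ n _) (R-word⁺ n _) e

Qtrees-exist : ∀ n → ∃ λ ts → Qpaths n ≡ map word ts × Enumerates ts (Graded QTree n)
Qtrees-exist n =
  let ts , eq , e = enum-trees (λ ((_ , dyck , _) , _) → dyck)
                      (enum-filter (Q? n) (length-Dyck ∘ proj₁) (enum-words (2 ℕ.* n)))
  in ts , eq , enum-resp (Q-word⁻ n _) (Q-word⁺ n _) e

-- The trees of size n of each class.  The pyramid is the only tree of size n
-- that has no valley.
Rtrees Qtrees Strees : ℕ → List Tree
Rtrees n = proj₁ (Rtrees-exist n)
Qtrees n = proj₁ (Qtrees-exist n)
Strees n = pyramid n ∷ Qtrees n

enum-Rtrees : ∀ n → Enumerates (Rtrees n) (Graded RTree n)
enum-Rtrees n = proj₂ (proj₂ (Rtrees-exist n))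

enum-Qtrees : ∀ n → Enumerates (Qtrees n) (Graded QTree n)
enum-Qtrees n = proj₂ (proj₂ (Qtrees-exist n))

enum-Strees : ∀ n → Enumerates (Strees n) (Graded STree n)
enum-Strees n = enum-resp STree⁺ STree⁻ (enum-∷ pyramid∉Q (enum-Qtrees n))
  where
  pyramid∉Q : ∀ {t} → Graded QTree n t → pyramid n ≢ t
  pyramid∉Q (_ , _ , low) refl rewrite levels-pyramid n with low
  ... | ()

count-words : ∀ ts → + length (map word ts) ≡ weight unit ts
count-words ts = trans (cong +_ (length-map word ts)) (weight-1 ts)

area-words : ∀ ts → sumℤ (map area (map word ts)) ≡ weight treeArea ts
area-words ts = trans (weight-map area word ts) (weight-cong area-word ts)

r≡ : ∀ n → r n ≡ weight unit (Rtrees n)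
r≡ n = trans (cong (λ ps → + length ps) (proj₁ (proj₂ (Rtrees-exist n)))) (count-words (Rtrees n))

a≡ : ∀ n → a n ≡ weight treeArea (Rtrees n)
a≡ n = trans (cong (weight area) (proj₁ (proj₂ (Rtrees-exist n)))) (area-words (Rtrees n))

q≡ : ∀ n → q n ≡ weight unit (Qtrees n)
q≡ n = trans (cong (λ ps → + length ps) (proj₁ (proj₂ (Qtrees-exist n)))) (count-words (Qtrees n))

A≡ : ∀ n → A n ≡ weight treeArea (Qtrees n)
A≡ n = trans (cong (weight area) (proj₁ (proj₂ (Qtrees-exist n)))) (area-words (Qtrees n))

-- F with its entry at size 0, the empty path, removed.
nonempty : (ℕ → List Tree) → ℕ → List Tree
nonempty F zero    = []
nonempty F (suc n) = F (suc n)

NonLeaf : (Tree → Set) → Tree → Set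
NonLeaf P t = P t × t ≢ leaf

enum-nonempty : ∀ P {F} → (∀ n → Enumerates (F n) (Graded P n)) →
  ∀ n → Enumerates (nonempty F n) (Graded (NonLeaf P) n)
enum-nonempty P e zero = record
  { unique   = []
  ; sound    = λ ()
  ; complete = λ { {leaf} (_ , _ , t≢leaf) → ⊥-elim (t≢leaf refl) }
  }
enum-nonempty P e (suc n) = enum-resp to (λ (sz , p , _) → sz , p) (e (suc n))
  where
  to : ∀ {t} → Graded P (suc n) t → Graded (NonLeaf P) (suc n) t
  to {leaf}     (() , _)
  to {node s t} (sz , p) = sz , p , λ ()

-- The decompositions of the two classes

-- A path of class Q returns to the axis before its end.  At the first return
-- there is a valley at level 0, so the part before is of class S; the part after
-- is nonempty, and its last valley, if any, is the last valley of the path.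
enum-Qnodes : ∀ n → Enumerates (nodes Strees (nonempty Strees) n) (Graded QTree (suc n))
enum-Qnodes n = enum-resp to from
  (enum-nodes {P′ = Graded (NonLeaf STree)} (graded-injective STree)
    enum-Strees (enum-nonempty STree enum-Strees) n)
  where
  to : ∀ {t} → Nodes (Graded STree) (Graded (NonLeaf STree)) n t →
    Graded QTree (suc n) t
  to (s , t , (_ , _ , i+j , (refl , ss) , (refl , st , t≢leaf)) , refl) =
    cong suc i+j , QTree-node⁺ {s} {t} ss st t≢leaf
  from : ∀ {t} → Graded QTree (suc n) t →
    Nodes (Graded STree) (Graded (NonLeaf STree)) n t
  from {node s t} (sz , qt) = let ss , st , t≢leaf = QTree-node⁻ s t qt in
    s , t , (size s , size t , ℕ.suc-injective sz , (refl , ss) , (refl , st , t≢leaf)) , refl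

-- A nonempty (-1)-Dyck path is U p D for a (-1)-Dyck path p, or has a valley at
-- its first return; the nonempty part after that valley is then unrestricted.
enum-Rnodes : ∀ n → Enumerates
  (map (λ s → node s leaf) (Rtrees n) ++ nodes Strees (nonempty Rtrees) n)
  (Graded RTree (suc n))
enum-Rnodes n = enum-resp to from
  (enum-++ disjoint
    (enum-map (λ { refl → refl }) (enum-Rtrees n))
    (enum-nodes {P′ = Graded (NonLeaf RTree)} (graded-injective STree)
      enum-Strees (enum-nonempty RTree enum-Rtrees) n))
  where
  Cap Cat : Tree → Set
  Cap u = ∃ λ s → Graded RTree n s × u ≡ node s leaf
  Cat = Nodes (Graded STree) (Graded (NonLeaf RTree)) n
  disjoint : ∀ {u} → Cap u → Cat u → ⊥
  disjoint (_ , _ , refl) (_ , _ , (_ , _ , _ , _ , (_ , _ , t≢leaf)) , refl) = t≢leaf refl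
  to : ∀ {u} → Cap u ⊎ Cat u → Graded RTree (suc n) u
  to (inj₁ (s , (refl , rs) , refl)) = cong suc (ℕ.+-identityʳ (size s)) , linked-suc⁺ rs
  to (inj₂ (s , t , (_ , _ , i+j , (refl , ss) , (refl , rt , t≢leaf)) , refl)) =
    cong suc i+j , RTree-node⁺ {s} {t} ss rt t≢leaf
  from : ∀ {u} → Graded RTree (suc n) u → Cap u ⊎ Cat u
  from {node s leaf} (sz , ru) =
    inj₁ (s , (trans (sym (ℕ.+-identityʳ (size s))) (ℕ.suc-injective sz) , linked-suc⁻ ru) , refl)
  from {node s t@(node _ _)} (sz , ru) =
    let rs , low , rt = linked-join⁻ (levels s) ru in
    inj₂ (s , t , (size s , size t , ℕ.suc-injective sz , (refl , rs , low) , (refl , rt , λ ())) , refl)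

weight-nonempty : ∀ (f : Tree → ℤ) (F : ℕ → List Tree) {g : ℕ → ℤ} →
  (∀ n → g n ≡ weight f (F n)) → drop₀ g ≗ weight f ∘ nonempty F
weight-nonempty f F g≡ zero    = refl
weight-nonempty f F g≡ (suc n) = g≡ (suc n)

-- The convolution identities

open Recurrences r a q A refl refl refl refl refl refl refl refl

s≡ : ∀ n → s n ≡ weight unit (Strees n)
s≡ n = cong (λ x → 1ℤ + x) (q≡ n)

B≡ : ∀ n → B n ≡ weight treeArea (Strees n)
B≡ n = cong₂ _+_ (sym (area-pyramid n)) (A≡ n)

T≡ : ∀ n → T n ≡ weight liftedArea (Strees n)
T≡ n = trans (cong₂ (λ x y → x + (+ 2 * + n + 1ℤ) * y) (B≡ n) (s≡ n))
  (sym (weight-lifted n (Strees n) (proj₁ ∘ sound (enum-Strees n))))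

undrop : ∀ {f} → f 0 ≡ 0ℤ → f ≗ drop₀ f
undrop f0 zero    = f0
undrop f0 (suc n) = refl

q-step : ∀ n → q (suc n) ≡ conv s (drop₀ s) n
q-step n = begin
  q (suc n)
    ≡⟨ q≡ (suc n) ⟩
  weight unit (Qtrees (suc n))
    ≡⟨ weight-↭ unit (enum-↭ (enum-Qtrees (suc n)) (enum-Qnodes n)) ⟩
  weight unit (nodes Strees (nonempty Strees) n)
    ≡⟨ weight-nodes unit unit unit (λ _ _ → refl) Strees (nonempty Strees) n ⟩
  conv (weight unit ∘ Strees) (weight unit ∘ nonempty Strees) n
    ≡⟨ conv-cong s≡ (weight-nonempty unit Strees s≡) n ⟨
  conv s (drop₀ s) n ∎
  where open ≡-Reasoning

A-step : ∀ n → A (suc n) ≡ conv T (drop₀ s) n + conv s B n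
A-step n = begin
  A (suc n)
    ≡⟨ A≡ (suc n) ⟩
  weight treeArea (Qtrees (suc n))
    ≡⟨ weight-↭ treeArea (enum-↭ (enum-Qtrees (suc n)) (enum-Qnodes n)) ⟩
  weight treeArea (nodes Strees (nonempty Strees) n)
    ≡⟨ area-nodes Strees (nonempty Strees) n ⟩
  _
    ≡⟨ cong₂ _+_ (conv-cong T≡ (weight-nonempty unit Strees s≡) n)
         (conv-cong s≡ (λ i → trans (undrop {B} refl i) (weight-nonempty treeArea Strees B≡ i)) n) ⟨
  conv T (drop₀ s) n + conv s B n ∎
  where open ≡-Reasoning

r-step : ∀ n → r (suc n) ≡ r n + conv s (drop₀ r) n
r-step n = begin
  r (suc n)
    ≡⟨ r≡ (suc n) ⟩
  weight unit (Rtrees (suc n))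
    ≡⟨ weight-↭ unit (enum-↭ (enum-Rtrees (suc n)) (enum-Rnodes n)) ⟩
  weight unit (map (λ s → node s leaf) (Rtrees n) ++ nodes Strees (nonempty Rtrees) n)
    ≡⟨ weight-++ unit (map (λ s → node s leaf) (Rtrees n)) _ ⟩
  _
    ≡⟨ cong₂ _+_ (weight-map unit (λ s → node s leaf) (Rtrees n))
                 (weight-nodes unit unit unit (λ _ _ → refl) Strees (nonempty Rtrees) n) ⟩
  _
    ≡⟨ cong₂ _+_ (r≡ n) (conv-cong s≡ (weight-nonempty unit Rtrees r≡) n) ⟨
  r n + conv s (drop₀ r) n ∎
  where open ≡-Reasoning

a-step : ∀ n → a (suc n) ≡ (a n + (+ 2 * + n + 1ℤ) * r n)
                         + (conv T (drop₀ r) n + conv s a n)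
a-step n = begin
  a (suc n)
    ≡⟨ a≡ (suc n) ⟩
  weight treeArea (Rtrees (suc n))
    ≡⟨ weight-↭ treeArea (enum-↭ (enum-Rtrees (suc n)) (enum-Rnodes n)) ⟩
  weight treeArea (map (λ s → node s leaf) (Rtrees n) ++ nodes Strees (nonempty Rtrees) n)
    ≡⟨ weight-++ treeArea (map (λ s → node s leaf) (Rtrees n)) _ ⟩
  _
    ≡⟨ cong₂ _+_ (trans (weight-map treeArea (λ s → node s leaf) (Rtrees n))
                   (trans (weight-cong (λ s → ℤ.+-identityʳ (liftedArea s)) (Rtrees n))
                     (weight-lifted n (Rtrees n) (proj₁ ∘ sound (enum-Rtrees n)))))
                 (area-nodes Strees (nonempty Rtrees) n) ⟩
  _
    ≡⟨ cong₂ _+_ (cong₂ (λ x y → x + (+ 2 * + n + 1ℤ) * y) (a≡ n) (r≡ n))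
         (cong₂ _+_ (conv-cong T≡ (weight-nonempty unit Rtrees r≡) n)
           (conv-cong s≡ (λ i → trans (undrop {a} refl i) (weight-nonempty treeArea Rtrees a≡ i)) n)) ⟨
  _ ∎
  where open ≡-Reasoning

open FromConvolutions q-step A-step r-step a-step using (A-recurrence; a-recurrence)

theorem4p2 :
  ( ((n : ℕ) → n > 4 →
      A n ≡ + 2 * A (n ∸ 1) + A (n ∸ 2) + + 2 * A (n ∸ 3)
          + q n - q (n ∸ 1)
          + + 2 * + n * q (n ∸ 2)
          + + 2 * (+ n - + 5) * q (n ∸ 3)
          + + 4 * (+ n) ^ 2 - + 14 * + n + + 13
          + ∑ 2 (n ∸ 4) (λ i →
              + 2 * (A i + + i * q i + + i * (+ i + + 1))
                * (q (n ∸ i ∸ 1) - q (n ∸ i ∸ 2))))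
    × A 1 ≡ + 0 × A 2 ≡ + 2 × A 3 ≡ + 13 × A 4 ≡ + 58 )
  ×
  ((n : ℕ) → n ≥ 4 →
      a n ≡ + 3 * a (n ∸ 1) - a (n ∸ 2) + A (n ∸ 2)
          + + 2 * (+ n - + 1) * q (n ∸ 2)
          + + 2 * + n * r (n ∸ 1)
          + + 2 * (+ 3 - + n) * r (n ∸ 2)
          - + 4 * r (n ∸ 3)
          + (+ n - + 1) ^ 2
          + ∑ 3 (n ∸ 2) (λ i →
              q (i ∸ 1) * (a (n ∸ i) - a (n ∸ i ∸ 1)))
          + ∑ 3 (n ∸ 2) (λ i →
              (A (i ∸ 1) + (+ 2 * + i - + 1) * q (i ∸ 1) + (+ i) ^ 2)
                * (r (n ∸ i) - r (n ∸ i ∸ 1))))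
theorem4p2 =
  ( (λ { _ (s≤s (s≤s (s≤s (s≤s (s≤s {n = m} _))))) → A-recurrence m })
  , refl , refl , refl , refl )
  , λ { _ (s≤s (s≤s (s≤s (s≤s {n = m} _)))) → a-recurrence m }
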